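{- (i) For every $\varepsilon>0$ there is a sequence of instances $(\mathcal{T}_n,w_n)$ (finite trees with weight functions $w_n:V(\mathcal{T}_n)\to\mathbb{R}_{\ge0}$) with $w_n(\mathcal{T}_n)=1$ and $\lim_{n\to\infty}\mathtt{OPT}(\mathcal{T}_n,w_n)=\infty$, such that every centroid tree $C_n$ of $(\mathcal{T}_n,w_n)$ satisfies $$\mathtt{cost}_{w_n}(C_n)\ge 2\cdot\mathtt{OPT}(\mathcal{T}_n,w_n)-1-\varepsilon.$$ (ii) There is a sequence of instances $(\mathcal{T}_n,w_n)$, where $w_n$ is the uniform probability distribution on $V(\mathcal{T}_n)$, with $\lim_{n\to\infty}\mathtt{OPT}(\mathcal{T}_n,w_n)=\infty$, such that for every choice of centroid trees $C_n$ of $(\mathcal{T}_n,w_n)$, $$\lim_{n\to\infty}\frac{\mathtt{cost}_{w_n}(C_n)}{\mathtt{OPT}(\mathcal{T}_n,w_n)}=2.$$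
   Context: For a subgraph $\mathcal{H}$ of $\mathcal{T}$, $w(\mathcal{H})=\sum_{x\in V(\mathcal{H})}w(x)$. A search tree on a tree $\mathcal{T}$ is a rooted tree $T$ with vertex set $V(\mathcal{T})$ defined recursively: its root is an arbitrary vertex $r$, and the children of $r$ are the roots of search trees built on the connected components of $\mathcal{T}-r$; a single-vertex tree has only itself as search tree. $\mathtt{cost}_w(T)=\sum_x w(x)\,\mathtt{depth}_T(x)$ with root depth $1$; $\mathtt{OPT}(\mathcal{T},w)$ is the minimum cost over all search trees on $\mathcal{T}$. A vertex $v$ is a centroid of $(\mathcal{T},w)$ if each component $\mathcal{H}$ of $\mathcal{T}-v$ has $w(\mathcal{H})\le w(\mathcal{T})/2$. A search tree $T$ is a centroid tree if each vertex $x$ is a centroid of $(\mathcal{T}[V(T_x)],w)$, $T_x$ being the subtree of $T$ rooted at $x$. -}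

module Defs where

open import Data.Nat.Base as ℕ using (ℕ; zero; suc)
import Data.Nat.Properties as ℕₚ
open import Data.Integer.Base as ℤ using ()
open import Data.Rational.Base as ℚ using (ℚ; 0ℚ; 1ℚ; ½)
import Data.Rational.Properties as ℚₚ
open import Data.Rational.Solver using (module +-*-Solver)
open import Data.Fin.Base as Fin using (Fin)
open import Data.Fin.Subset as Subset using (Subset; ⊤; _∈_)
open import Data.Fin.Subset.Properties using (_∈?_)
open import Data.List.Base using (List; []; _∷_; _++_; foldr; map; filter; allFin)
import Data.List.Membership.Propositional as List
open import Data.List.Relation.Unary.All using (All; []; _∷_)
open import Data.List.Relation.Unary.Unique.Propositional using (Unique)
open import Data.Product using (Σ-syntax; ∃-syntax; _×_; _,_; proj₁; proj₂)
import Data.Unit.Base as Unit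
open import Function.Bundles using (_⇔_)
open import Function.Definitions using (Injective)
open import Relation.Binary.Construct.Closure.ReflexiveTransitive using (Star)
open import Relation.Binary.Definitions using (Symmetric; Decidable)
open import Relation.Binary.PropositionalEquality
  using (_≡_; refl; sym; trans; cong; cong₂; subst; subst₂)
open import Relation.Nullary using (¬_; yes; no; contradiction)

------------------------------------------------------------------------
-- Rational arithmetic used to build the reals

private
  pos-* : ∀ {p q} → 0ℚ ℚ.< p → 0ℚ ℚ.< q → 0ℚ ℚ.< p ℚ.* q
  pos-* {p} {q} 0<p 0<q = subst (ℚ._< p ℚ.* q) (ℚₚ.*-zeroʳ p)
    (ℚₚ.*-monoʳ-<-pos p {{ℚ.positive 0<p}} 0<q)

  pos-½* : ∀ {p} → 0ℚ ℚ.< p → 0ℚ ℚ.< ½ ℚ.* p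
  pos-½* = pos-* (ℚₚ.positive⁻¹ ½)

  halves : ∀ p → ½ ℚ.* p ℚ.+ ½ ℚ.* p ≡ p
  halves p = trans (sym (ℚₚ.*-distribʳ-+ p ½ ½)) (ℚₚ.*-identityˡ p)

  mono-* : ∀ {p q r s} → 0ℚ ℚ.≤ r → 0ℚ ℚ.≤ q →
           p ℚ.≤ q → r ℚ.≤ s → p ℚ.* r ℚ.≤ q ℚ.* s
  mono-* {p} {q} {r} {s} 0≤r 0≤q p≤q r≤s = ℚₚ.≤-trans
    (ℚₚ.*-monoʳ-≤-nonNeg r {{ℚ.nonNegative 0≤r}} p≤q)
    (ℚₚ.*-monoˡ-≤-nonNeg q {{ℚ.nonNegative 0≤q}} r≤s)

  0≤+ : ∀ {p q} → 0ℚ ℚ.≤ p → 0ℚ ℚ.≤ q → 0ℚ ℚ.≤ p ℚ.+ q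
  0≤+ = ℚₚ.+-mono-≤

  ≤-+ʳ : ∀ p {q} → 0ℚ ℚ.≤ q → p ℚ.≤ p ℚ.+ q
  ≤-+ʳ p {q} 0≤q = subst (ℚ._≤ p ℚ.+ q) (ℚₚ.+-identityʳ p) (ℚₚ.+-monoʳ-≤ p 0≤q)

  ≤-+ˡ : ∀ p {q} → 0ℚ ℚ.≤ q → p ℚ.≤ q ℚ.+ p
  ≤-+ˡ p {q} 0≤q = subst (ℚ._≤ q ℚ.+ p) (ℚₚ.+-identityˡ p) (ℚₚ.+-monoˡ-≤ p 0≤q)

-- The reciprocal of a rational, with value 0 at 0.
recip : ℚ → ℚ
recip q with q ℚₚ.≟ 0ℚ
... | yes _   = 0ℚ
... | no q≢0 = (ℚ.1/ q) {{ℚ.≢-nonZero q≢0}}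

recip-inverseˡ : ∀ {q} → 0ℚ ℚ.< q → recip q ℚ.* q ≡ 1ℚ
recip-inverseˡ {q} 0<q with q ℚₚ.≟ 0ℚ
... | yes q≡0 = contradiction (sym q≡0) (ℚₚ.<⇒≢ 0<q)
... | no q≢0  = ℚₚ.*-inverseˡ q {{ℚ.≢-nonZero q≢0}}

recip-pos : ∀ {q} → 0ℚ ℚ.< q → 0ℚ ℚ.< recip q
recip-pos {q} 0<q = ℚₚ.*-cancelʳ-<-nonNeg q {{ℚ.nonNegative (ℚₚ.<⇒≤ 0<q)}}
  (subst₂ ℚ._<_ (sym (ℚₚ.*-zeroˡ q)) (sym (recip-inverseˡ 0<q)) (ℚₚ.positive⁻¹ 1ℚ))

------------------------------------------------------------------------
-- Real numbers, as Cauchy sequences of rationals up to _≃_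

Cauchy : (ℕ → ℚ) → Set
Cauchy s = ∀ ε → 0ℚ ℚ.< ε → ∃[ N ] ∀ m n → N ℕ.≤ m → N ℕ.≤ n →
           ℚ.∣ s m ℚ.- s n ∣ ℚ.≤ ε

record ℝ : Set where
  constructor mkℝ
  field
    seq    : ℕ → ℚ
    cauchy : Cauchy seq

open ℝ public

infix 4 _≤_ _<_ _≃_

_≤_ : ℝ → ℝ → Set
x ≤ y = ∀ ε → 0ℚ ℚ.< ε → ∃[ N ] ∀ n → N ℕ.≤ n → seq x n ℚ.≤ seq y n ℚ.+ ε

_<_ : ℝ → ℝ → Set
x < y = ∃[ ε ] 0ℚ ℚ.< ε × (∃[ N ] ∀ n → N ℕ.≤ n → seq x n ℚ.+ ε ℚ.≤ seq y n)

_≃_ : ℝ → ℝ → Set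
x ≃ y = x ≤ y × y ≤ x

fromℚ : ℚ → ℝ
fromℚ q = mkℝ (λ _ → q) λ ε 0<ε → 0 , λ _ _ _ _ →
  subst (ℚ._≤ ε) (cong ℚ.∣_∣ (sym (ℚₚ.+-inverseʳ q))) (ℚₚ.<⇒≤ 0<ε)

fromℕ : ℕ → ℝ
fromℕ k = fromℚ (ℤ.+ k ℚ./ 1)

0ℝ 1ℝ 2ℝ ½ℝ : ℝ
0ℝ = fromℕ 0
1ℝ = fromℕ 1
2ℝ = fromℕ 2
½ℝ = fromℚ ½

infixl 6 _+_ _-_
infixl 7 _*_
infix  8 -_

_+_ : ℝ → ℝ → ℝ
x + y = mkℝ (λ n → seq x n ℚ.+ seq y n) λ ε 0<ε →
  let Nx , hx = cauchy x (½ ℚ.* ε) (pos-½* 0<ε)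
      Ny , hy = cauchy y (½ ℚ.* ε) (pos-½* 0<ε)
  in Nx ℕ.⊔ Ny , λ m n N≤m N≤n →
    let a = seq x m ; a′ = seq x n ; b = seq y m ; b′ = seq y n in
    begin
      ℚ.∣ (a ℚ.+ b) ℚ.- (a′ ℚ.+ b′) ∣              ≡⟨ cong ℚ.∣_∣ (regroup a b a′ b′) ⟩
      ℚ.∣ (a ℚ.- a′) ℚ.+ (b ℚ.- b′) ∣              ≤⟨ ℚₚ.∣p+q∣≤∣p∣+∣q∣ (a ℚ.- a′) (b ℚ.- b′) ⟩
      ℚ.∣ a ℚ.- a′ ∣ ℚ.+ ℚ.∣ b ℚ.- b′ ∣            ≤⟨ ℚₚ.+-mono-≤
        (hx m n (ℕₚ.m⊔n≤o⇒m≤o Nx Ny N≤m) (ℕₚ.m⊔n≤o⇒m≤o Nx Ny N≤n))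
        (hy m n (ℕₚ.m⊔n≤o⇒n≤o Nx Ny N≤m) (ℕₚ.m⊔n≤o⇒n≤o Nx Ny N≤n)) ⟩
      ½ ℚ.* ε ℚ.+ ½ ℚ.* ε                          ≡⟨ halves ε ⟩
      ε ∎
  where
  open ℚₚ.≤-Reasoning
  regroup : ∀ a b a′ b′ → (a ℚ.+ b) ℚ.- (a′ ℚ.+ b′) ≡ (a ℚ.- a′) ℚ.+ (b ℚ.- b′)
  regroup = solve 4 (λ a b a′ b′ →
    (a :+ b) :- (a′ :+ b′) := (a :- a′) :+ (b :- b′)) refl
    where open +-*-Solver

-_ : ℝ → ℝ
- x = mkℝ (λ n → ℚ.- seq x n) λ ε 0<ε →
  let N , h = cauchy x ε 0<ε
  in N , λ m n N≤m N≤n →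
    subst (ℚ._≤ ε) (trans (sym (ℚₚ.∣-p∣≡∣p∣ _)) (cong ℚ.∣_∣ (regroup (seq x m) (seq x n))))
      (h m n N≤m N≤n)
  where
  regroup : ∀ a a′ → ℚ.- (a ℚ.- a′) ≡ (ℚ.- a) ℚ.- (ℚ.- a′)
  regroup = solve 2 (λ a a′ → :- (a :- a′) := (:- a) :- (:- a′)) refl
    where open +-*-Solver

_-_ : ℝ → ℝ → ℝ
x - y = x + (- y)

private
  bounded : ∀ x → ∃[ B ] 0ℚ ℚ.< B × (∃[ N ] ∀ n → N ℕ.≤ n → ℚ.∣ seq x n ∣ ℚ.≤ B)
  bounded x = ℚ.∣ c ∣ ℚ.+ 1ℚ
            , ℚₚ.+-mono-≤-< (ℚₚ.0≤∣p∣ c) (ℚₚ.positive⁻¹ 1ℚ)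
            , N , λ n N≤n → begin
      ℚ.∣ seq x n ∣                         ≡⟨ cong ℚ.∣_∣ (regroup (seq x n) c) ⟩
      ℚ.∣ c ℚ.+ (seq x n ℚ.- c) ∣           ≤⟨ ℚₚ.∣p+q∣≤∣p∣+∣q∣ c (seq x n ℚ.- c) ⟩
      ℚ.∣ c ∣ ℚ.+ ℚ.∣ seq x n ℚ.- c ∣       ≤⟨ ℚₚ.+-monoʳ-≤ ℚ.∣ c ∣ (h n N N≤n ℕₚ.≤-refl) ⟩
      ℚ.∣ c ∣ ℚ.+ 1ℚ                        ∎
    where
    open ℚₚ.≤-Reasoning
    N = proj₁ (cauchy x 1ℚ (ℚₚ.positive⁻¹ 1ℚ))
    h = proj₂ (cauchy x 1ℚ (ℚₚ.positive⁻¹ 1ℚ))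
    c = seq x N
    regroup : ∀ a c → a ≡ c ℚ.+ (a ℚ.- c)
    regroup = solve 2 (λ a c → a := c :+ (a :- c)) refl
      where open +-*-Solver

_*_ : ℝ → ℝ → ℝ
x * y = mkℝ (λ n → seq x n ℚ.* seq y n) λ ε 0<ε →
  let Bx , 0<Bx , Nx , hx = bounded x
      By , 0<By , Ny , hy = bounded y
      B   = Bx ℚ.+ By
      0<B = ℚₚ.+-mono-< 0<Bx 0<By
      δ   = ½ ℚ.* (ε ℚ.* recip B)
      0<δ = pos-½* (pos-* 0<ε (recip-pos 0<B))
      Mx , kx = cauchy x δ 0<δ
      My , ky = cauchy y δ 0<δ
      N₁ = Nx ℕ.⊔ Ny
      N₂ = Mx ℕ.⊔ My
  in N₁ ℕ.⊔ N₂ , λ m n N≤m N≤n →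
    let a = seq x m ; a′ = seq x n ; b = seq y m ; b′ = seq y n
        N₁≤m = ℕₚ.m⊔n≤o⇒m≤o N₁ N₂ N≤m
        N₁≤n = ℕₚ.m⊔n≤o⇒m≤o N₁ N₂ N≤n
        N₂≤m = ℕₚ.m⊔n≤o⇒n≤o N₁ N₂ N≤m
        N₂≤n = ℕₚ.m⊔n≤o⇒n≤o N₁ N₂ N≤n
        ∣a∣≤B  = ℚₚ.≤-trans (hx m (ℕₚ.m⊔n≤o⇒m≤o Nx Ny N₁≤m)) (≤-+ʳ Bx (ℚₚ.<⇒≤ 0<By))
        ∣b′∣≤B = ℚₚ.≤-trans (hy n (ℕₚ.m⊔n≤o⇒n≤o Nx Ny N₁≤n)) (≤-+ˡ By (ℚₚ.<⇒≤ 0<Bx))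
        da = kx m n (ℕₚ.m⊔n≤o⇒m≤o Mx My N₂≤m) (ℕₚ.m⊔n≤o⇒m≤o Mx My N₂≤n)
        db = ky m n (ℕₚ.m⊔n≤o⇒n≤o Mx My N₂≤m) (ℕₚ.m⊔n≤o⇒n≤o Mx My N₂≤n)
    in begin
      ℚ.∣ a ℚ.* b ℚ.- a′ ℚ.* b′ ∣
        ≡⟨ cong ℚ.∣_∣ (regroup a b a′ b′) ⟩
      ℚ.∣ a ℚ.* (b ℚ.- b′) ℚ.+ b′ ℚ.* (a ℚ.- a′) ∣
        ≤⟨ ℚₚ.∣p+q∣≤∣p∣+∣q∣ (a ℚ.* (b ℚ.- b′)) (b′ ℚ.* (a ℚ.- a′)) ⟩
      ℚ.∣ a ℚ.* (b ℚ.- b′) ∣ ℚ.+ ℚ.∣ b′ ℚ.* (a ℚ.- a′) ∣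
        ≡⟨ cong₂ ℚ._+_ (ℚₚ.∣p*q∣≡∣p∣*∣q∣ a (b ℚ.- b′)) (ℚₚ.∣p*q∣≡∣p∣*∣q∣ b′ (a ℚ.- a′)) ⟩
      ℚ.∣ a ∣ ℚ.* ℚ.∣ b ℚ.- b′ ∣ ℚ.+ ℚ.∣ b′ ∣ ℚ.* ℚ.∣ a ℚ.- a′ ∣
        ≤⟨ ℚₚ.+-mono-≤
             (mono-* (ℚₚ.0≤∣p∣ (b ℚ.- b′)) (ℚₚ.<⇒≤ 0<B) ∣a∣≤B db)
             (mono-* (ℚₚ.0≤∣p∣ (a ℚ.- a′)) (ℚₚ.<⇒≤ 0<B) ∣b′∣≤B da) ⟩
      B ℚ.* δ ℚ.+ B ℚ.* δ
        ≡⟨ factor B ε (recip B) ½ ⟩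
      (½ ℚ.* ε ℚ.+ ½ ℚ.* ε) ℚ.* (recip B ℚ.* B)
        ≡⟨ cong₂ ℚ._*_ (halves ε) (recip-inverseˡ 0<B) ⟩
      ε ℚ.* 1ℚ
        ≡⟨ ℚₚ.*-identityʳ ε ⟩
      ε ∎
  where
  open ℚₚ.≤-Reasoning
  regroup : ∀ a b a′ b′ → a ℚ.* b ℚ.- a′ ℚ.* b′ ≡ a ℚ.* (b ℚ.- b′) ℚ.+ b′ ℚ.* (a ℚ.- a′)
  regroup = solve 4 (λ a b a′ b′ →
    a :* b :- a′ :* b′ := a :* (b :- b′) :+ b′ :* (a :- a′)) refl
    where open +-*-Solver
  factor : ∀ B ε r h → B ℚ.* (h ℚ.* (ε ℚ.* r)) ℚ.+ B ℚ.* (h ℚ.* (ε ℚ.* r))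
         ≡ (h ℚ.* ε ℚ.+ h ℚ.* ε) ℚ.* (r ℚ.* B)
  factor = solve 4 (λ B ε r h → B :* (h :* (ε :* r)) :+ B :* (h :* (ε :* r))
         := (h :* ε :+ h :* ε) :* (r :* B)) refl
    where open +-*-Solver

inverse : (x : ℝ) → 0ℝ < x → ℝ
inverse x (d , 0<d , M , hd) = mkℝ (λ n → recip (seq x n)) λ ε 0<ε →
  let N , h = cauchy x (ε ℚ.* (d ℚ.* d)) (pos-* 0<ε (pos-* 0<d 0<d))
  in M ℕ.⊔ N , λ m n N≤m N≤n →
    let a = seq x m ; b = seq x n
        d≤a = d≤ m (ℕₚ.m⊔n≤o⇒m≤o M N N≤m)
        d≤b = d≤ n (ℕₚ.m⊔n≤o⇒m≤o M N N≤n)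
        0<a = ℚₚ.<-≤-trans 0<d d≤a
        0<b = ℚₚ.<-≤-trans 0<d d≤b
        i = recip a ; j = recip b
        0≤i = ℚₚ.<⇒≤ (recip-pos 0<a)
        0≤j = ℚₚ.<⇒≤ (recip-pos 0<b)
        0≤ij = ℚₚ.<⇒≤ (pos-* (recip-pos 0<a) (recip-pos 0<b))
        0≤ε = ℚₚ.<⇒≤ 0<ε
        0≤d = ℚₚ.<⇒≤ 0<d
    in begin
      ℚ.∣ i ℚ.- j ∣
        ≡⟨ cong ℚ.∣_∣ (cong₂ ℚ._-_ (sym (ℚₚ.*-identityʳ i)) (sym (ℚₚ.*-identityʳ j))) ⟩
      ℚ.∣ i ℚ.* 1ℚ ℚ.- j ℚ.* 1ℚ ∣
        ≡⟨ cong ℚ.∣_∣ (cong₂ (λ u v → i ℚ.* u ℚ.- j ℚ.* v)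
             (sym (recip-inverseˡ 0<b)) (sym (recip-inverseˡ 0<a))) ⟩
      ℚ.∣ i ℚ.* (j ℚ.* b) ℚ.- j ℚ.* (i ℚ.* a) ∣
        ≡⟨ cong ℚ.∣_∣ (regroup i j a b) ⟩
      ℚ.∣ (b ℚ.- a) ℚ.* (i ℚ.* j) ∣
        ≡⟨ ℚₚ.∣p*q∣≡∣p∣*∣q∣ (b ℚ.- a) (i ℚ.* j) ⟩
      ℚ.∣ b ℚ.- a ∣ ℚ.* ℚ.∣ i ℚ.* j ∣
        ≡⟨ cong (ℚ.∣ b ℚ.- a ∣ ℚ.*_) (ℚₚ.0≤p⇒∣p∣≡p 0≤ij) ⟩
      ℚ.∣ b ℚ.- a ∣ ℚ.* (i ℚ.* j)
        ≤⟨ ℚₚ.*-monoʳ-≤-nonNeg (i ℚ.* j) {{ℚ.nonNegative 0≤ij}}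
             (h n m (ℕₚ.m⊔n≤o⇒n≤o M N N≤n) (ℕₚ.m⊔n≤o⇒n≤o M N N≤m)) ⟩
      ε ℚ.* (d ℚ.* d) ℚ.* (i ℚ.* j)
        ≡⟨ factor ε d i j ⟩
      ε ℚ.* ((i ℚ.* d) ℚ.* (j ℚ.* d))
        ≤⟨ ℚₚ.*-monoˡ-≤-nonNeg ε {{ℚ.nonNegative 0≤ε}}
             (mono-* (subst (ℚ._≤ j ℚ.* d) (ℚₚ.*-zeroʳ j)
                        (ℚₚ.*-monoˡ-≤-nonNeg j {{ℚ.nonNegative 0≤j}} 0≤d))
                     (ℚₚ.<⇒≤ (ℚₚ.positive⁻¹ 1ℚ))
                     (recip*d≤1 0<a 0≤i d≤a) (recip*d≤1 0<b 0≤j d≤b)) ⟩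
      ε ℚ.* (1ℚ ℚ.* 1ℚ)
        ≡⟨ ℚₚ.*-identityʳ ε ⟩
      ε ∎
  where
  open ℚₚ.≤-Reasoning
  d≤ : ∀ n → M ℕ.≤ n → d ℚ.≤ seq x n
  d≤ n M≤n = subst (ℚ._≤ seq x n) (ℚₚ.+-identityˡ d) (hd n M≤n)
  recip*d≤1 : ∀ {a} → 0ℚ ℚ.< a → 0ℚ ℚ.≤ recip a → d ℚ.≤ a → recip a ℚ.* d ℚ.≤ 1ℚ
  recip*d≤1 {a} 0<a 0≤i d≤a = subst (recip a ℚ.* d ℚ.≤_) (recip-inverseˡ 0<a)
    (ℚₚ.*-monoˡ-≤-nonNeg (recip a) {{ℚ.nonNegative 0≤i}} d≤a)
  regroup : ∀ i j a b → i ℚ.* (j ℚ.* b) ℚ.- j ℚ.* (i ℚ.* a) ≡ (b ℚ.- a) ℚ.* (i ℚ.* j)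
  regroup = solve 4 (λ i j a b →
    i :* (j :* b) :- j :* (i :* a) := (b :- a) :* (i :* j)) refl
    where open +-*-Solver
  factor : ∀ ε d i j → ε ℚ.* (d ℚ.* d) ℚ.* (i ℚ.* j) ≡ ε ℚ.* ((i ℚ.* d) ℚ.* (j ℚ.* d))
  factor = solve 4 (λ ε d i j →
    ε :* (d :* d) :* (i :* j) := ε :* ((i :* d) :* (j :* d))) refl
    where open +-*-Solver

divide : ℝ → (y : ℝ) → 0ℝ < y → ℝ
divide x y 0<y = x * inverse y 0<y

syntax divide x y 0<y = x ÷ y [ 0<y ]

sum : List ℝ → ℝ
sum = foldr _+_ 0ℝ

infix 4 _⟶_ _⟶∞

_⟶_ : (ℕ → ℝ) → ℝ → Set
x ⟶ l = ∀ ε → 0ℝ < ε → ∃[ N ] ∀ n → N ℕ.≤ n → l - ε ≤ x n × x n ≤ l + ε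

_⟶∞ : (ℕ → ℝ) → Set
x ⟶∞ = ∀ b → ∃[ N ] ∀ n → N ℕ.≤ n → b ≤ x n

------------------------------------------------------------------------
-- Trees

record Graph : Set₁ where
  field
    order    : ℕ
    Adj      : Fin order → Fin order → Set
    adj?     : Decidable Adj
    adj-sym  : Symmetric Adj
    adj-irr  : ∀ v → ¬ Adj v v

  Vertex : Set
  Vertex = Fin order

  Connected : Set
  Connected = ∀ u v → Star Adj u v

  -- Vertices c₀, …, c₍ₖ₊₂₎, pairwise distinct and cyclically adjacent.
  Cycle : Set
  Cycle = ∃[ k ] Σ[ c ∈ (Fin (3 ℕ.+ k) → Vertex) ]
    Injective _≡_ _≡_ c ×
    (∀ i → Adj (c (Fin.inject₁ i)) (c (Fin.suc i))) ×
    Adj (c (Fin.fromℕ (2 ℕ.+ k))) (c Fin.zero)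

  -- Adjacency and reachability in the subgraph induced by S.
  AdjIn : Subset order → Vertex → Vertex → Set
  AdjIn S u v = u ∈ S × v ∈ S × Adj u v

  ReachableIn : Subset order → Vertex → Vertex → Set
  ReachableIn S = Star (AdjIn S)

  -- H is the vertex set of a connected component of the subgraph induced by S.
  IsComponent : Subset order → Subset order → Set
  IsComponent S H = ∃[ v ] v ∈ S × (∀ u → u ∈ H ⇔ ReachableIn S v u)

record Tree : Set₁ where
  field
    graph     : Graph
  open Graph graph public
  field
    nonEmpty  : ℕ.NonZero order
    connected : Connected
    acyclic   : ¬ Cycle

------------------------------------------------------------------------
-- Search trees

module _ (𝒯 : Tree) where
  open Tree 𝒯

  -- Search trees on the subgraph induced by S, whose vertex set is S.  The list
  -- Hs enumerates the components left after deleting the root r from S, each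
  -- exactly once, so r has exactly one child for each of them.
  data SearchTreeOn (S : Subset order) : Set where
    node : (r : Vertex) → r ∈ S →
           (Hs : List (Subset order)) → Unique Hs →
           (∀ H → H List.∈ Hs ⇔ IsComponent (S Subset.- r) H) →
           All SearchTreeOn Hs →
           SearchTreeOn S

  SearchTree : Set
  SearchTree = SearchTreeOn ⊤

module _ {𝒯 : Tree} where
  open Tree 𝒯

  -- The vertices of a search tree with their depths, given the depth of the root.
  mutual
    depthsFrom : ∀ {S} → ℕ → SearchTreeOn 𝒯 S → List (Vertex × ℕ)
    depthsFrom d (node r _ _ _ _ ts) = (r , d) ∷ depthsFromAll (suc d) ts

    depthsFromAll : ∀ {Hs} → ℕ → All (SearchTreeOn 𝒯) Hs → List (Vertex × ℕ)
    depthsFromAll d []       = []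
    depthsFromAll d (t ∷ ts) = depthsFrom d t ++ depthsFromAll d ts

  depths : ∀ {S} → SearchTreeOn 𝒯 S → List (Vertex × ℕ)
  depths = depthsFrom 1

------------------------------------------------------------------------
-- Weighted instances

record Instance : Set₁ where
  field
    tree   : Tree
  open Tree tree public
  field
    weight : Vertex → ℝ
    nonNeg : ∀ v → 0ℝ ≤ weight v

uniform : Tree → Instance
uniform 𝒯 = record
  { tree   = 𝒯
  ; weight = λ _ → fromℚ 1/∣V∣
  ; nonNeg = λ _ ε 0<ε → 0 , λ _ _ → 0≤+ (ℚₚ.nonNegative⁻¹ 1/∣V∣) (ℚₚ.<⇒≤ 0<ε)
  }
  where
  open Tree 𝒯
  1/∣V∣ : ℚ
  1/∣V∣ = (ℤ.+ 1 ℚ./ order) {{nonEmpty}}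
  instance
    1/∣V∣-nonNeg : ℚ.NonNegative 1/∣V∣
    1/∣V∣-nonNeg = ℚₚ.normalize-nonNeg 1 order {{nonEmpty}}

module _ (I : Instance) where
  open Instance I

  weightOf : Subset order → ℝ
  weightOf S = sum (map weight (filter (_∈? S) (allFin order)))

  totalWeight : ℝ
  totalWeight = weightOf ⊤

  cost : SearchTree tree → ℝ
  cost T = sum (map (λ (x , d) → weight x * fromℕ d) (depths T))

  -- o is the minimum cost over all search trees.  This determines o up to _≃_;
  -- OPT is a relation because selecting a minimiser among real costs is not
  -- constructive in general.
  IsOPT : ℝ → Set
  IsOPT o = (∃[ T ] cost T ≃ o) × (∀ T → o ≤ cost T)

  -- v is a centroid of the subgraph induced by S.
  IsCentroid : Subset order → Vertex → Set
  IsCentroid S v = v ∈ S ×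
    (∀ H → IsComponent (S Subset.- v) H → weightOf H ≤ weightOf S * ½ℝ)

  mutual
    AllCentroids : ∀ {S} → SearchTreeOn tree S → Set
    AllCentroids {S} (node r _ _ _ _ ts) = IsCentroid S r × AllCentroidsAll ts

    AllCentroidsAll : ∀ {Hs} → All (SearchTreeOn tree) Hs → Set
    AllCentroidsAll []       = Unit.⊤
    AllCentroidsAll (t ∷ ts) = AllCentroids t × AllCentroidsAll ts

  IsCentroidTree : SearchTree tree → Set
  IsCentroidTree = AllCentroids

{-# OPTIONS --safe #-}
-- Let X 0 be a vertex of weight K, and obtain X (n + 1) from two copies of X n by joining their
-- apexes through a new vertex, the centre, of weight 1; the apex of X (n + 1) is that of the left copy.
-- The centre separates the copies evenly and is the only centroid, so that a centroid tree pays the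
-- whole weight for each halving.  Starting with the apex instead, one may search the left copy as if
-- it were alone, and the right copy together with the centre one level deeper: a halving then costs
-- only half the weight, up to a small correction for the centres.  No search tree does much better, as
-- the first vertex searched is outside one of the two copies.  With K = 1 all weights are equal, and a
-- large K makes the weight of the centres, and with it the correction, negligible.
module Submission where

open import Defs using (Graph; Tree; SearchTreeOn; node; depthsFrom; depthsFromAll; depths;
  Instance; IsCentroid; AllCentroids; AllCentroidsAll)
open import Data.Fin.Base as Fin using (Fin)
import Data.Fin.Properties as Fin
open import Data.Fin.Subset as Subset using (Subset; ⊤)
open import Data.Fin.Subset.Properties using (_∈?_; ∈⊤)
open import Data.List.Base as List using (List; []; _∷_)
import Data.List.Membership.Propositional as List
import Data.List.Membership.Propositional.Properties as List
import Data.List.Properties as List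
open import Data.List.Relation.Binary.Permutation.Propositional as ↭ using (_↭_)
open import Data.List.Relation.Unary.All as All using (All; []; _∷_)
import Data.List.Relation.Unary.All.Properties as All
open import Data.List.Relation.Unary.AllPairs using (AllPairs; []; _∷_)
open import Data.List.Relation.Unary.Any using (here; there)
open import Data.List.Relation.Unary.Unique.Propositional using (Unique)
import Data.List.Relation.Unary.Unique.DecPropositional.Properties as Unique
open import Data.Nat.Base as ℕ using (ℕ; zero; suc; NonZero)
open import Data.Nat.ListAction as ℕ using ()
import Data.Nat.Properties as ℕ
open import Data.Nat.Tactic.RingSolver using (solve-∀)
open import Data.Product using (Σ-syntax; ∃; ∃-syntax; _×_; _,_; proj₁; proj₂)
open import Data.Rational.Base as ℚ using (ℚ; 0ℚ; 1ℚ; ½; ↧ₙ_)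
import Data.Rational.Properties as ℚ
open import Data.Rational.Solver using (module +-*-Solver)
open import Data.Sum using (_⊎_; inj₁; inj₂; [_,_]′)
open import Function.Base using (_∘_; _$_; id; case_of_)
open import Function.Bundles using (_⇔_; mk⇔; Equivalence)
open import Relation.Binary.Construct.Closure.ReflexiveTransitive as Star using (Star; _◅_; _◅◅_)
open import Relation.Binary.Definitions using (DecidableEquality; Symmetric)
open import Relation.Binary.PropositionalEquality
open import Relation.Nullary using (¬_; Dec; does; yes; no; contradiction)
open import Relation.Nullary.Decidable using (_×-dec_; _⊎-dec_; map′)
open import Relation.Unary using (Decidable)

open Equivalence using (to; from)

-- The centre is there to break a tie. If the apexes were joined by an edge, deleting one of them
-- would leave the other copy with exactly half of the weight, so each apex would be a centroid and
-- the cheap search itself a centroid tree. One more unit of weight between the copies rules this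
-- out. The obstacle in the lower bound is that a search tree of the whole interleaves the searches
-- of its copies. Instead of extracting a search tree for each copy, one counts for each vertex of a
-- copy only those ancestors that lie in the copy. These restricted costs permit an induction on `n`
-- in which the search tree itself never changes. All weights are natural numbers over a common
-- denominator `D`, the total weight. With `c` the cost of a centroid tree and `opt` the optimum,
-- both before division by `D`, the outcome is `c ≤ 2 * opt + D` and `2 * opt ≤ c + D + 4 * 2 ^ n`.
-- In the second inequality `D` becomes the 1 of (i); the first one gives the upper half of the
-- limit in (ii).

module Subgraphs where
  open import Data.Bool.Base using (true)
  import Data.Bool.Properties as Bool
  open import Data.Fin.Subset
  open import Data.Fin.Subset.Properties
  open import Data.Nat.Base using (ℕ; zero; suc; _+_; _≤_; _<_; z≤n; s≤s)
  open import Data.Nat.ListAction using (sum)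
  open import Data.Nat.Properties
  open import Data.Vec.Base using ([]; _∷_; here; there; tabulate)
  import Data.Vec.Properties as Vec
  open import Relation.Binary.Construct.Closure.ReflexiveTransitive using (ε)

  -- Subsets of a finite set and their weights.

  module _ {n : ℕ} where

    comprehension : ∀ {P : Fin n → Set} → Decidable P → Subset n
    comprehension P? = tabulate (does ∘ P?)

    ∈-comprehension : ∀ {P : Fin n → Set} (P? : Decidable P) {x} → x ∈ comprehension P? ⇔ P x
    ∈-comprehension {P} P? {x} = mk⇔ fwd bwd
      where
      fwd : x ∈ comprehension P? → P x
      fwd x∈ with P? x | trans (sym (Vec.lookup∘tabulate (does ∘ P?) x)) (Vec.[]=⇒lookup x∈)
      ... | yes p | _ = p
      bwd : P x → x ∈ comprehension P?
      bwd p = Vec.lookup⇒[]= x _ (trans (Vec.lookup∘tabulate (does ∘ P?) x) eq)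
        where
        eq : does (P? x) ≡ true
        eq with P? x
        ... | yes _ = refl
        ... | no ¬p = contradiction p ¬p

    ⇔⇒≡ : ∀ {S T : Subset n} → (∀ x → x ∈ S ⇔ x ∈ T) → S ≡ T
    ⇔⇒≡ S⇔T = ⊆-antisym (λ {x} → to (S⇔T x)) (λ {x} → from (S⇔T x))

  x∈p─q⇒x∉q : ∀ {n} (p q : Subset n) {x} → x ∈ p ─ q → x ∉ q
  x∈p─q⇒x∉q (_ ∷ p) (_ ∷ q) (there x∈) (there x∈q) = x∈p─q⇒x∉q p q x∈ x∈q

  x∈p-y⇒x≢y : ∀ {n} (p : Subset n) {x y} → x ∈ p - y → x ≢ y
  x∈p-y⇒x≢y p x∈ refl = x∈p─q⇒x∉q p _ x∈ (x∈⁅x⁆ _)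

  x∈p-y⇒x∈p : ∀ {n} (p : Subset n) {x y} → x ∈ p - y → x ∈ p
  x∈p-y⇒x∈p p = p─q⊆p p _

  Disjoint : ∀ {n} → Subset n → Subset n → Set
  Disjoint A B = ∀ {x} → x ∈ A → x ∉ B

  wt : ∀ {n} → (Fin n → ℕ) → Subset n → ℕ
  wt w []            = 0
  wt w (inside  ∷ S) = w Fin.zero + wt (w ∘ Fin.suc) S
  wt w (outside ∷ S) = wt (w ∘ Fin.suc) S

  wt-mono : ∀ {n} (w : Fin n → ℕ) {S T} → S ⊆ T → wt w S ≤ wt w T
  wt-mono w {[]}          {[]}          S⊆T = z≤n
  wt-mono w {inside ∷ S}  {inside ∷ T}  S⊆T = +-monoʳ-≤ _ (wt-mono _ (drop-∷-⊆ S⊆T))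
  wt-mono w {inside ∷ S}  {outside ∷ T} S⊆T = contradiction (S⊆T here) λ ()
  wt-mono w {outside ∷ S} {inside ∷ T}  S⊆T = m≤n⇒m≤o+n _ (wt-mono _ (drop-∷-⊆ S⊆T))
  wt-mono w {outside ∷ S} {outside ∷ T} S⊆T = wt-mono _ (drop-∷-⊆ S⊆T)

  wt-⊥ : ∀ {n} (w : Fin n → ℕ) → wt w ⊥ ≡ 0
  wt-⊥ {zero}  w = refl
  wt-⊥ {suc n} w = wt-⊥ {n} (w ∘ Fin.suc)

  wt-⁅⁆ : ∀ {n} (w : Fin n → ℕ) v → wt w ⁅ v ⁆ ≡ w v
  wt-⁅⁆ w Fin.zero    = trans (cong (w Fin.zero +_) (wt-⊥ (w ∘ Fin.suc))) (+-identityʳ _)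
  wt-⁅⁆ w (Fin.suc v) = wt-⁅⁆ (w ∘ Fin.suc) v

  wt-∪ : ∀ {n} (w : Fin n → ℕ) {A B} → Disjoint A B → wt w (A ∪ B) ≡ wt w A + wt w B
  wt-∪ w {[]} {[]} A#B = refl
  wt-∪ w {inside ∷ A}  {inside ∷ B}  A#B = contradiction here (A#B here)
  wt-∪ w {inside ∷ A}  {outside ∷ B} A#B = trans
    (cong (w Fin.zero +_) (wt-∪ _ λ x∈A x∈B → A#B (there x∈A) (there x∈B)))
    (sym (+-assoc (w Fin.zero) _ _))
  wt-∪ w {outside ∷ A} {inside ∷ B}  A#B = trans
    (cong (w Fin.zero +_) (wt-∪ _ λ x∈A x∈B → A#B (there x∈A) (there x∈B)))
    (trans (sym (+-assoc (w Fin.zero) a b))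
      (trans (cong (_+ b) (+-comm (w Fin.zero) a)) (+-assoc a _ _)))
    where
    a = wt (w ∘ Fin.suc) A
    b = wt (w ∘ Fin.suc) B
  wt-∪ w {outside ∷ A} {outside ∷ B} A#B = wt-∪ _ λ x∈A x∈B → A#B (there x∈A) (there x∈B)

  wt-⊆∪ : ∀ {n} (w : Fin n → ℕ) {S A B} → (∀ {x} → x ∈ S → x ∈ A ⊎ x ∈ B) →
          wt w S ≤ wt w A + wt w B
  wt-⊆∪ w {S} {A} {B} cover = begin
    wt w S                       ≤⟨ wt-mono w S⊆ ⟩
    wt w (A ∪ (B ─ A))           ≡⟨ wt-∪ w (λ x∈A x∈B─A → x∈p─q⇒x∉q B A x∈B─A x∈A) ⟩
    wt w A + wt w (B ─ A)        ≤⟨ +-monoʳ-≤ _ (wt-mono w (p─q⊆p B A)) ⟩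
    wt w A + wt w B              ∎
    where
    open ≤-Reasoning
    S⊆ : S ⊆ A ∪ (B ─ A)
    S⊆ {x} x∈S with x ∈? A
    ... | yes x∈A = x∈p∪q⁺ (inj₁ x∈A)
    ... | no x∉A  = x∈p∪q⁺ (inj₂ ([ (λ x∈A → contradiction x∈A x∉A)
                                  , (λ x∈B → x∈p∧x∉q⇒x∈p─q x∈B x∉A) ]′ (cover x∈S)))

  wt-⋃ : ∀ {n} (w : Fin n → ℕ) {Hs} → AllPairs Disjoint Hs →
         wt w (⋃ Hs) ≡ sum (List.map (wt w) Hs)
  wt-⋃ w []                      = wt-⊥ w
  wt-⋃ w {H ∷ Hs} (H#Hs ∷ disj) = trans (wt-∪ w (disjoint-⋃ H#Hs)) (cong (wt w H +_) (wt-⋃ w disj))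
    where
    disjoint-⋃ : ∀ {Hs} → All (Disjoint H) Hs → Disjoint H (⋃ Hs)
    disjoint-⋃ []             x∈H x∈⊥ = ∉⊥ x∈⊥
    disjoint-⋃ {H₁ ∷ Hs} (H#H₁ ∷ H#Hs) x∈H x∈ =
      [ H#H₁ x∈H , disjoint-⋃ H#Hs x∈H ]′ (x∈p∪q⁻ H₁ (⋃ Hs) x∈)

  ∈-⋃⁺ : ∀ {n} {Hs : List (Subset n)} {H x} → H List.∈ Hs → x ∈ H → x ∈ ⋃ Hs
  ∈-⋃⁺ (here refl)  x∈H = x∈p∪q⁺ (inj₁ x∈H)
  ∈-⋃⁺ (there H∈Hs) x∈H = x∈p∪q⁺ (inj₂ (∈-⋃⁺ H∈Hs x∈H))

  ∈-⋃⁻ : ∀ {n} (Hs : List (Subset n)) {x} → x ∈ ⋃ Hs → ∃[ H ] H List.∈ Hs × x ∈ H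
  ∈-⋃⁻ []       x∈⊥ = contradiction x∈⊥ ∉⊥
  ∈-⋃⁻ (H ∷ Hs) x∈  with x∈p∪q⁻ H (⋃ Hs) x∈
  ... | inj₁ x∈H  = H , here refl , x∈H
  ... | inj₂ x∈Hs = let H′ , H′∈Hs , x∈H′ = ∈-⋃⁻ Hs x∈Hs in H′ , there H′∈Hs , x∈H′

  -- Stated for an arbitrary `f` because the induction removes the first index and passes to
  -- `f ∘ Fin.suc`. At `f = id` it links `weightOf`, which filters `allFin`, with `wt`.
  sum-filter : ∀ {m n} (w : Fin m → ℕ) {P : Fin m → Set} (P? : Decidable P) (f : Fin n → Fin m)
               (S : Subset n) → (∀ i → i ∈ S ⇔ P (f i)) →
               sum (List.map w (List.filter P? (List.tabulate f))) ≡ wt (w ∘ f) S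
  sum-filter w P? f []       S⇔P = refl
  sum-filter w P? f (s ∷ S) S⇔P with P? (f Fin.zero) | S⇔P Fin.zero
  sum-filter w P? f (inside  ∷ S) S⇔P | yes p | _ = cong (w (f Fin.zero) +_)
    (sum-filter w P? (f ∘ Fin.suc) S λ i → mk⇔ (to (S⇔P (Fin.suc i)) ∘ there) (drop-there ∘ from (S⇔P (Fin.suc i))))
  sum-filter w P? f (outside ∷ S) S⇔P | yes p | e = contradiction (from e p) λ ()
  sum-filter w P? f (inside  ∷ S) S⇔P | no ¬p | e = contradiction (to e here) ¬p
  sum-filter w P? f (outside ∷ S) S⇔P | no ¬p | _ =
    sum-filter w P? (f ∘ Fin.suc) S λ i → mk⇔ (to (S⇔P (Fin.suc i)) ∘ there) (drop-there ∘ from (S⇔P (Fin.suc i)))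

  -- Reachability and connected components of induced subgraphs.

  module Components (G : Graph) where
    open Graph G

    reach-mono : ∀ {S T u v} → S ⊆ T → ReachableIn S u v → ReachableIn T u v
    reach-mono S⊆T = Star.map λ (u∈S , v∈S , uv) → S⊆T u∈S , S⊆T v∈S , uv

    reach-sym : ∀ {S u v} → ReachableIn S u v → ReachableIn S v u
    reach-sym = Star.reverse λ (u∈S , v∈S , uv) → v∈S , u∈S , adj-sym uv

    reach-closed : ∀ {S} (P : Vertex → Set) → (∀ {u v} → AdjIn S u v → P u → P v) →
                   ∀ {u v} → ReachableIn S u v → P u → P v
    reach-closed P closed ε        pu = pu
    reach-closed P closed (a ◅ as) pu = reach-closed P closed as (closed a pu)

    reach-from-∉ : ∀ {S u v} → u ∉ S → ReachableIn S u v → u ≡ v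
    reach-from-∉ u∉S ε                = refl
    reach-from-∉ u∉S ((u∈S , _) ◅ _) = contradiction u∈S u∉S

    -- Cutting a walk at its last visit to u.
    last-exit : ∀ {S u v} → u ≢ v → ∀ {y} → ReachableIn S y v →
                ReachableIn (S - u) y v ⊎ (∃[ x ] AdjIn S u x × ReachableIn (S - u) x v)
    last-exit u≢v ε = inj₁ ε
    last-exit {S} {u} u≢v {y} (_◅_ {j = z} a@(y∈S , z∈S , yz) as) with last-exit u≢v as
    ... | inj₂ found = inj₂ found
    ... | inj₁ rest with y Fin.≟ u | z Fin.≟ u
    ...   | yes refl | _        = inj₂ (z , a , rest)
    ...   | no _     | yes refl = contradiction (reach-from-∉ (λ u∈ → x∈p-y⇒x≢y S u∈ refl) rest) u≢v
    ...   | no y≢u  | no z≢u  = inj₁ ((x∈p∧x≢y⇒x∈p-y y∈S y≢u , x∈p∧x≢y⇒x∈p-y z∈S z≢u , yz) ◅ rest)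

    -- After its last visit to `u`, a walk continues from a neighbour of `u` inside `S - u`, a
    -- smaller set. The bound `k` makes the recursion on the size structural.
    reach? : ∀ k S → ∣ S ∣ < k → ∀ u v → Dec (ReachableIn S u v)
    reach? (suc k) S (s≤s ∣S∣≤k) u v with u Fin.≟ v
    ... | yes refl = yes ε
    ... | no u≢v with u ∈? S
    ...   | no u∉S = no λ r → u≢v (reach-from-∉ u∉S r)
    ...   | yes u∈S = map′ fwd bwd
            (Fin.any? λ x → (x ∈? S ×-dec adj? u x) ×-dec
               reach? k (S - u) (<-≤-trans (x∈p⇒∣p-x∣<∣p∣ u∈S) ∣S∣≤k) x v)
      where
      fwd : (∃[ x ] (x ∈ S × Adj u x) × ReachableIn (S - u) x v) → ReachableIn S u v
      fwd (x , (x∈S , ux) , r) = (u∈S , x∈S , ux) ◅ reach-mono (p─q⊆p S _) r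
      bwd : ReachableIn S u v → ∃[ x ] (x ∈ S × Adj u x) × ReachableIn (S - u) x v
      bwd r with last-exit u≢v r
      ... | inj₁ r′ = contradiction (reach-from-∉ (λ u∈ → x∈p-y⇒x≢y S u∈ refl) r′) u≢v
      ... | inj₂ (x , (_ , x∈S , ux) , r′) = x , (x∈S , ux) , r′

    abstract
      component : Subset order → Vertex → Subset order
      component S v = comprehension (reach? (suc ∣ S ∣) S ≤-refl v)

      ∈-component : ∀ {S v u} → u ∈ component S v ⇔ ReachableIn S v u
      ∈-component {S} {v} = ∈-comprehension (reach? (suc ∣ S ∣) S ≤-refl v)

    component-isComponent : ∀ {S v} → v ∈ S → IsComponent S (component S v)
    component-isComponent {S} {v} v∈S = v , v∈S , λ u → ∈-component

    component-⊆ : ∀ {S H} → IsComponent S H → H ⊆ S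
    component-⊆ {S} (v , v∈S , H⇔) x∈H =
      reach-closed (_∈ S) (λ (_ , v∈S , _) _ → v∈S) (to (H⇔ _) x∈H) v∈S

    component-closed : ∀ {S H} → IsComponent S H → ∀ {u v} → u ∈ H → ReachableIn S u v → v ∈ H
    component-closed (_ , _ , H⇔) u∈H r = from (H⇔ _) (to (H⇔ _) u∈H ◅◅ r)

    component-connected : ∀ {S H} → IsComponent S H → ∀ {u v} → u ∈ H → v ∈ H → ReachableIn S u v
    component-connected (_ , _ , H⇔) u∈H v∈H = reach-sym (to (H⇔ _) u∈H) ◅◅ to (H⇔ _) v∈H

    component-unique : ∀ {S H H′ x} → IsComponent S H → IsComponent S H′ → x ∈ H → x ∈ H′ → H ≡ H′
    component-unique {S} cH cH′ x∈H x∈H′ = ⇔⇒≡ λ y → mk⇔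
      (λ y∈H → component-closed cH′ x∈H′ (component-connected cH x∈H y∈H))
      (λ y∈H′ → component-closed cH x∈H (component-connected cH′ x∈H′ y∈H′))

    isComponent : ∀ {S H v} → v ∈ H → H ⊆ S → (∀ {u} → u ∈ H → ReachableIn S v u) →
                  (∀ {x y} → AdjIn S x y → x ∈ H → y ∈ H) → IsComponent S H
    isComponent {S} {H} {v} v∈H H⊆S conn closed =
      v , H⊆S v∈H , λ u → mk⇔ conn (λ r → reach-closed (_∈ H) closed r v∈H)

    components : Subset order → List (Subset order)
    components S = List.deduplicate (Vec.≡-dec Bool._≟_)
      (List.map (component S) (List.filter (_∈? S) (List.allFin order)))

    components-unique : ∀ S → Unique (components S)
    components-unique S = Unique.deduplicate-! (Vec.≡-dec Bool._≟_) _

    ∈-components : ∀ S H → H List.∈ components S ⇔ IsComponent S H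
    ∈-components S H = mk⇔ fwd bwd
      where
      fwd : H List.∈ components S → IsComponent S H
      fwd H∈ with List.∈-map⁻ (component S) (List.∈-deduplicate⁻ _ _ H∈)
      ... | v , v∈ , refl = component-isComponent (proj₂ (List.∈-filter⁻ (_∈? S) {xs = List.allFin order} v∈))
      bwd : IsComponent S H → H List.∈ components S
      bwd c@(v , v∈S , H⇔) with component-unique (component-isComponent v∈S) c (from ∈-component ε) (from (H⇔ v) ε)
      ... | refl = List.∈-deduplicate⁺ _
        (List.∈-map⁺ (component S) (List.∈-filter⁺ (_∈? S) (List.∈-allFin v) v∈S))

    components-disjoint : ∀ {S Hs} → Unique Hs → (∀ {H} → H List.∈ Hs → IsComponent S H) →
                          AllPairs Disjoint Hs
    components-disjoint []             comp = []
    components-disjoint (H≢Hs ∷ uniq) comp =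
      all-disjoint H≢Hs (comp (here refl)) (comp ∘ there) ∷ components-disjoint uniq (comp ∘ there)
      where
      all-disjoint : ∀ {S H Hs} → All (H ≢_) Hs → IsComponent S H →
                     (∀ {H′} → H′ List.∈ Hs → IsComponent S H′) → All (Disjoint H) Hs
      all-disjoint []            cH comp = []
      all-disjoint (H≢H′ ∷ H≢) cH comp =
        (λ x∈H x∈H′ → H≢H′ (component-unique cH (comp (here refl)) x∈H x∈H′))
        ∷ all-disjoint H≢ cH (comp ∘ there)

    wt-components : ∀ (w : Vertex → ℕ) {S r Hs} → r ∈ S → Unique Hs →
                    (∀ H → H List.∈ Hs ⇔ IsComponent (S - r) H) →
                    wt w S ≡ w r + sum (List.map (wt w) Hs)
    wt-components w {S} {r} {Hs} r∈S uniq Hs⇔ = begin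
      wt w S                                     ≡⟨ cong (wt w) (⇔⇒≡ λ x → mk⇔ fwd bwd) ⟩
      wt w (⁅ r ⁆ ∪ ⋃ Hs)                        ≡⟨ wt-∪ w disj ⟩
      wt w ⁅ r ⁆ + wt w (⋃ Hs)                   ≡⟨ cong₂ _+_ (wt-⁅⁆ w r) (wt-⋃ w (components-disjoint uniq (to (Hs⇔ _)))) ⟩
      w r + sum (List.map (wt w) Hs)        ∎
      where
      open ≡-Reasoning
      ⋃⊆ : ⋃ Hs ⊆ S - r
      ⋃⊆ x∈ = let H , H∈ , x∈H = ∈-⋃⁻ Hs x∈ in component-⊆ (to (Hs⇔ H) H∈) x∈H
      fwd : ∀ {x} → x ∈ S → x ∈ ⁅ r ⁆ ∪ ⋃ Hs
      fwd {x} x∈S with x Fin.≟ r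
      ... | yes refl = x∈p∪q⁺ (inj₁ (x∈⁅x⁆ x))
      ... | no x≢r = x∈p∪q⁺ (inj₂ (∈-⋃⁺
        (from (Hs⇔ _) (component-isComponent (x∈p∧x≢y⇒x∈p-y x∈S x≢r))) (from ∈-component ε)))
      bwd : ∀ {x} → x ∈ ⁅ r ⁆ ∪ ⋃ Hs → x ∈ S
      bwd x∈ with x∈p∪q⁻ ⁅ r ⁆ (⋃ Hs) x∈
      ... | inj₁ x∈r rewrite x∈⁅y⁆⇒x≡y r x∈r = r∈S
      ... | inj₂ x∈⋃ = x∈p-y⇒x∈p S (⋃⊆ x∈⋃)
      disj : Disjoint ⁅ r ⁆ (⋃ Hs)
      disj x∈r x∈⋃ = x∈p-y⇒x≢y S (⋃⊆ x∈⋃) (x∈⁅y⁆⇒x≡y r x∈r)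

-- Costs of search trees in natural numbers, optimal trees, and the attachment of branches.

module SearchTrees where
  open Subgraphs
  open import Data.Fin.Subset
  open import Data.Fin.Subset.Properties
  open import Data.List.Membership.Propositional.Properties.WithK using (unique∧set⇒bag)
  open import Data.List.Relation.Binary.BagAndSetEquality using (∼bag⇒↭)
  open import Data.Nat.Base using (ℕ; suc; _+_; _*_; _≤_; _<_; z≤n; s≤s)
  open import Data.Nat.ListAction using (sum)
  open import Data.Nat.ListAction.Properties using (sum-++)
  open import Data.Nat.Properties
  open import Data.List.Extrema ≤-totalOrder using (argmin; f[argmin]≤f[xs])
  open import Relation.Binary.Construct.Closure.ReflexiveTransitive using (ε)

  module Trees (I : Instance) (w : Fin (Instance.order I) → ℕ) where
    open Instance I using (tree; graph; order; Vertex; Adj; adj-sym; ReachableIn; IsComponent)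
    open Components graph

    mutual
      -- The cost counted by subtrees: a vertex lies in the subtrees of exactly its ancestors,
      -- itself included, and their number is its depth.
      cst : ∀ {S} → SearchTreeOn tree S → ℕ
      cst {S} (node _ _ _ _ _ ts) = wt w S + cstAll ts

      cstAll : ∀ {Hs} → All (SearchTreeOn tree) Hs → ℕ
      cstAll []       = 0
      cstAll (t ∷ ts) = cst t + cstAll ts

    depthCost : List (Vertex × ℕ) → ℕ
    depthCost = sum ∘ List.map λ (v , d) → w v * d

    mutual
      -- Moving a tree down by `d` levels adds `d` to every depth, hence `d` times the weight to the
      -- cost. All `d` are treated at once because the children start one level lower.
      depthCost-depthsFrom : ∀ d {S} (T : SearchTreeOn tree S) →
                             depthCost (depthsFrom (suc d) T) ≡ cst T + d * wt w S
      depthCost-depthsFrom d {S} (node r r∈S Hs uniq Hs⇔ ts) = begin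
        w r * suc d + depthCost (depthsFromAll (suc (suc d)) ts)
          ≡⟨ cong (w r * suc d +_) (depthCost-depthsFromAll (suc d) ts) ⟩
        w r * suc d + (cstAll ts + suc d * b)
          ≡⟨ regroup (w r) b (cstAll ts) d ⟩
        (w r + b) + cstAll ts + d * (w r + b)
          ≡⟨ cong (λ a → a + cstAll ts + d * a) (wt-components w r∈S uniq Hs⇔) ⟨
        wt w S + cstAll ts + d * wt w S
          ∎
        where
        open ≡-Reasoning
        b = sum (List.map (wt w) Hs)
        regroup : ∀ a b c d → a * suc d + (c + suc d * b) ≡ (a + b) + c + d * (a + b)
        regroup = solve-∀

      depthCost-depthsFromAll : ∀ d {Hs} (ts : All (SearchTreeOn tree) Hs) →
        depthCost (depthsFromAll (suc d) ts) ≡ cstAll ts + d * sum (List.map (wt w) Hs)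
      depthCost-depthsFromAll d []       = sym (*-zeroʳ d)
      depthCost-depthsFromAll d {H ∷ Hs} (t ∷ ts) = begin
        depthCost (depthsFrom (suc d) t List.++ depthsFromAll (suc d) ts)
          ≡⟨ cong sum (List.map-++ _ (depthsFrom (suc d) t) _) ⟩
        sum (List.map _ (depthsFrom (suc d) t) List.++ List.map _ (depthsFromAll (suc d) ts))
          ≡⟨ sum-++ (List.map _ (depthsFrom (suc d) t)) _ ⟩
        depthCost (depthsFrom (suc d) t) + depthCost (depthsFromAll (suc d) ts)
          ≡⟨ cong₂ _+_ (depthCost-depthsFrom d t) (depthCost-depthsFromAll d ts) ⟩
        (cst t + d * wt w H) + (cstAll ts + d * b)
          ≡⟨ regroup (cst t) (cstAll ts) d (wt w H) b ⟩
        cst t + cstAll ts + d * (wt w H + b)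
          ∎
        where
        open ≡-Reasoning
        b = sum (List.map (wt w) Hs)
        regroup : ∀ x y d a b → (x + d * a) + (y + d * b) ≡ x + y + d * (a + b)
        regroup = solve-∀

    depthCost-depths : ∀ {S} (T : SearchTreeOn tree S) → depthCost (depths T) ≡ cst T
    depthCost-depths T = trans (depthCost-depthsFrom 0 T) (+-identityʳ _)

    -- A node may list its components in any order. This carries the subtrees over to a prescribed
    -- order, so that trees with the same root can be compared.
    permute : ∀ {Hs Hs′} → Hs ↭ Hs′ → (ts : All (SearchTreeOn tree) Hs) →
              Σ[ ts′ ∈ All (SearchTreeOn tree) Hs′ ]
                cstAll ts′ ≡ cstAll ts × (AllCentroidsAll I ts → AllCentroidsAll I ts′)
    permute ↭.refl         ts           = ts , refl , id
    permute (↭.prep H p)   (t ∷ ts)     =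
      let ts′ , eq , cen = permute p ts
      in t ∷ ts′ , cong (cst t +_) eq , λ (c , cs) → c , cen cs
    permute (↭.swap H J p) (t ∷ u ∷ ts) =
      let ts′ , eq , cen = permute p ts
      in u ∷ t ∷ ts′
         , trans (cong (λ x → cst u + (cst t + x)) eq) (swap-front (cst u) (cst t) (cstAll ts))
         , λ (c , d , cs) → d , c , cen cs
      where
      swap-front : ∀ a b c → a + (b + c) ≡ b + (a + c)
      swap-front = solve-∀
    permute (↭.trans p q)  ts           =
      let ts′ , eq , cen = permute p ts
          ts″ , eq′ , cen′ = permute q ts′
      in ts″ , trans eq′ eq , cen′ ∘ cen

    same-members⇒↭ : ∀ {Hs Hs′ : List (Subset order)} → Unique Hs → Unique Hs′ →
                     (∀ H → H List.∈ Hs ⇔ H List.∈ Hs′) → Hs ↭ Hs′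
    same-members⇒↭ uniq uniq′ same = ∼bag⇒↭ (unique∧set⇒bag uniq uniq′ (same _))

    Optimal : ∀ {S} → SearchTreeOn tree S → Set
    Optimal {S} T = ∀ T′ → cst T ≤ cst {S} T′

    root : ∀ {S} → SearchTreeOn tree S → Vertex
    root (node r _ _ _ _ _) = r

    optimal-children : ∀ {Hs} → All (λ H → ∃ (Optimal {H})) Hs →
      Σ[ ts ∈ All (SearchTreeOn tree) Hs ] ∀ ts′ → cstAll ts ≤ cstAll {Hs} ts′
    optimal-children []               = [] , λ _ → z≤n
    optimal-children ((t , opt) ∷ os) =
      let ts , opts = optimal-children os
      in t ∷ ts , λ { (t′ ∷ ts′) → +-mono-≤ (opt t′) (opts ts′) }

    -- For a fixed root, optimal trees on the remaining components, which are smaller, give an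
    -- optimal tree. Only the finitely many roots are then left to compare, and natural costs are
    -- comparable.
    optimal : ∀ k {S} → ∣ S ∣ < k → ∀ {v} → v ∈ S → ∃ (Optimal {S})
    optimal (suc k) {S} (s≤s ∣S∣≤k) {v} v∈S =
      proj₁ best , λ T → ≤-trans (best≤ (root T)) (candidate≤ T)
      where
      rooted : ∀ {r} → r ∈ S → Σ[ T ∈ SearchTreeOn tree S ] ∀ (T′ : SearchTreeOn tree S) → root T′ ≡ r → cst T ≤ cst T′
      rooted {r} r∈S =
        let ts , opt = optimal-children {components (S - r)} (All.tabulate λ {H} H∈ →
              let c@(x , _ , H⇔) = to (∈-components (S - r) H) H∈
              in optimal k (<-≤-trans (≤-<-trans (p⊆q⇒∣p∣≤∣q∣ (component-⊆ c)) (x∈p⇒∣p-x∣<∣p∣ r∈S)) ∣S∣≤k)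
                   (from (H⇔ x) ε))
        in node r r∈S _ (components-unique (S - r)) (∈-components (S - r)) ts
         , λ { (node .r _ Hs uniq Hs⇔ ts′) refl →
             let ts″ , eq , _ = permute (same-members⇒↭ uniq (components-unique (S - r)) λ H →
                   mk⇔ (from (∈-components (S - r) H) ∘ to (Hs⇔ H))
                       (from (Hs⇔ H) ∘ to (∈-components (S - r) H))) ts′
             in +-monoʳ-≤ (wt w S) (≤-trans (opt ts″) (≤-reflexive eq)) }
      candidate : Vertex → SearchTreeOn tree S
      candidate r with r ∈? S
      ... | yes r∈S = proj₁ (rooted r∈S)
      -- A vertex outside `S` gets the best tree rooted at `v` as a filler, so that the minimum can
      -- be taken over all vertices.
      ... | no _    = proj₁ (rooted v∈S)
      candidate≤ : ∀ (T : SearchTreeOn tree S) → cst (candidate (root T)) ≤ cst T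
      candidate≤ T@(node r r∈S _ _ _ _) with r ∈? S
      ... | yes r∈S′ = proj₂ (rooted r∈S′) T refl
      ... | no r∉S   = contradiction r∈S r∉S
      best : Σ[ T ∈ SearchTreeOn tree S ] All (λ T′ → cst T ≤ cst T′) (List.tabulate candidate)
      best = argmin cst (candidate v) (List.tabulate candidate) , f[argmin]≤f[xs] (candidate v) (List.tabulate candidate)
      best≤ : ∀ r → cst (proj₁ best) ≤ cst (candidate r)
      best≤ r = All.tabulate⁻ (proj₂ best) r

    -- Deleting the root of T from X ∪ B leaves B as a component of its own.
    addBranch : ∀ {X B b} (T : SearchTreeOn tree X) (T′ : SearchTreeOn tree B) → Disjoint X B →
                b ∈ B → (∀ {v} → v ∈ B → ReachableIn B b v) →
                (∀ {x y} → x ∈ X → y ∈ B → Adj x y → x ≡ root T) →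
                Σ[ T″ ∈ SearchTreeOn tree (X ∪ B) ]
                  root T″ ≡ root T × cst T″ ≡ cst T + (wt w B + cst T′)
    addBranch {X} {B} {b} (node r r∈X Hs uniq Hs⇔ ts) T′ X#B b∈B conn only-r =
      node r (x∈p∪q⁺ (inj₁ r∈X)) (B ∷ Hs) (All.tabulate B≢ ∷ uniq) (λ H → mk⇔ fwd bwd) (T′ ∷ ts)
      -- Among the old vertices only the root has its subtree enlarged by `B`, which accounts for
      -- the single `wt w B`.
      , refl , trans (cong (_+ (cst T′ + cstAll ts)) (wt-∪ w X#B)) (regroup (wt w X) (wt w B) (cst T′) (cstAll ts))
      where
      regroup : ∀ x b t s → x + b + (t + s) ≡ x + s + (b + t)
      regroup = solve-∀
      S′ = (X ∪ B) - r
      B⊆S′ : B ⊆ S′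
      B⊆S′ x∈B = x∈p∧x≢y⇒x∈p-y (x∈p∪q⁺ (inj₂ x∈B)) λ { refl → X#B r∈X x∈B }
      X-r⊆S′ : X - r ⊆ S′
      X-r⊆S′ x∈ = x∈p∧x≢y⇒x∈p-y (x∈p∪q⁺ (inj₁ (x∈p-y⇒x∈p X x∈))) (x∈p-y⇒x≢y X x∈)
      split : ∀ {x} → x ∈ S′ → x ∈ X - r ⊎ x ∈ B
      split x∈ with x∈p∪q⁻ X B (x∈p-y⇒x∈p (X ∪ B) x∈)
      ... | inj₁ x∈X = inj₁ (x∈p∧x≢y⇒x∈p-y x∈X (x∈p-y⇒x≢y (X ∪ B) x∈))
      ... | inj₂ x∈B = inj₂ x∈B
      no-edge : ∀ {x y} → x ∈ X - r → y ∈ B → ¬ Adj x y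
      no-edge x∈ y∈B xy = x∈p-y⇒x≢y X x∈ (only-r (x∈p-y⇒x∈p X x∈) y∈B xy)
      B-component : IsComponent S′ B
      B-component = isComponent b∈B B⊆S′ (λ u∈B → reach-mono B⊆S′ (conn u∈B)) λ (_ , y∈ , xy) x∈B →
        [ (λ y∈X → contradiction (adj-sym xy) (no-edge y∈X x∈B)) , id ]′ (split y∈)
      lift-component : ∀ {H} → IsComponent (X - r) H → IsComponent S′ H
      lift-component c@(v , _ , H⇔) = isComponent (from (H⇔ v) ε) (X-r⊆S′ ∘ component-⊆ c)
        (λ u∈H → reach-mono X-r⊆S′ (to (H⇔ _) u∈H)) λ (_ , y∈ , xy) x∈H →
          [ (λ y∈X → component-closed c x∈H ((component-⊆ c x∈H , y∈X , xy) ◅ ε))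
          , (λ y∈B → contradiction xy (no-edge (component-⊆ c x∈H) y∈B)) ]′ (split y∈)
      B≢ : ∀ {H} → H List.∈ Hs → B ≢ H
      B≢ H∈ refl = X#B (x∈p-y⇒x∈p X (component-⊆ (to (Hs⇔ _) H∈) b∈B)) b∈B
      fwd : ∀ {H} → H List.∈ B ∷ Hs → IsComponent S′ H
      fwd (here refl) = B-component
      fwd (there H∈)  = lift-component (to (Hs⇔ _) H∈)
      bwd : ∀ {H} → IsComponent S′ H → H List.∈ B ∷ Hs
      bwd c@(v , v∈S′ , H⇔) with split v∈S′
      ... | inj₂ v∈B = here (component-unique c B-component (from (H⇔ v) ε) v∈B)
      ... | inj₁ v∈X
        with refl ← component-unique c (lift-component (component-isComponent v∈X))
                      (from (H⇔ v) ε) (from ∈-component ε)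
        = there (from (Hs⇔ _) (component-isComponent v∈X))

    singleton : ∀ v → Σ[ T ∈ SearchTreeOn tree ⁅ v ⁆ ] root T ≡ v × cst T ≡ w v
    singleton v = node v (x∈⁅x⁆ v) [] [] (λ H → mk⇔ (λ ()) λ (x , x∈ , _) →
        contradiction (x∈⁅y⁆⇒x≡y v (x∈p-y⇒x∈p ⁅ v ⁆ x∈)) (x∈p-y⇒x≢y ⁅ v ⁆ x∈)) []
      , refl , trans (+-identityʳ _) (wt-⁅⁆ w v)

-- The trees `X n`: adjacency, acyclicity, numbering of the vertices.

module Shapes where
  open import Data.Fin.Base using (_↑ˡ_; _↑ʳ_; splitAt)
  open import Data.Fin.Relation.Unary.Top using (view; ‵fromℕ; ‵inject₁)
  open import Data.Nat.Base using (ℕ; zero; suc; _+_; _≤_; s≤s; s≤s⁻¹; NonZero; ≢-nonZero)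
  open import Data.Nat.Properties
  open import Data.List.Extrema ≤-totalOrder using (argmax; f[xs]≤f[argmax])
  open import Relation.Binary.Construct.Closure.ReflexiveTransitive using (ε)

  data Hand : Set where
    left right : Hand

  _≟ᴴ_ : DecidableEquality Hand
  left  ≟ᴴ left  = yes refl
  left  ≟ᴴ right = no λ ()
  right ≟ᴴ left  = no λ ()
  right ≟ᴴ right = yes refl

  -- The vertices of the binomial trees with every edge subdivided.
  data X : ℕ → Set where
    leaf   : X 0
    centre : ∀ {n} → X (suc n)
    copy   : ∀ {n} → Hand → X n → X (suc n)

  apex : ∀ {n} → X n
  apex {zero}  = leaf
  apex {suc n} = copy left apex

  infix 4 _~_
  -- The constructors carry an equation with `apex`, a function, instead of having it in their
  -- indices, where it would obstruct case analysis.
  data _~_ : ∀ {n} → X n → X n → Set where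
    within      : ∀ {n s} {a b : X n} → a ~ b → copy s a ~ copy s b
    to-centre   : ∀ {n s} {a : X n} → a ≡ apex → copy s a ~ centre
    from-centre : ∀ {n s} {a : X n} → a ≡ apex → centre ~ copy s a

  ~-sym : ∀ {n} → Symmetric (_~_ {n})
  ~-sym (within ab)     = within (~-sym ab)
  ~-sym (to-centre p)   = from-centre p
  ~-sym (from-centre p) = to-centre p

  ~-irrefl : ∀ {n} (a : X n) → ¬ a ~ a
  ~-irrefl (copy s a) (within aa) = ~-irrefl a aa

  apex? : ∀ {n} → Decidable (_≡ apex {n})
  apex? leaf           = yes refl
  apex? centre         = no λ ()
  apex? (copy left a)  = map′ (cong (copy left)) (λ { refl → refl }) (apex? a)
  apex? (copy right a) = no λ ()

  _~?_ : ∀ {n} (a b : X n) → Dec (a ~ b)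
  leaf     ~? leaf     = no λ ()
  centre   ~? centre   = no λ ()
  centre   ~? copy s b = map′ from-centre (λ { (from-centre p) → p }) (apex? b)
  copy s a ~? centre   = map′ to-centre (λ { (to-centre p) → p }) (apex? a)
  copy s a ~? copy t b with s ≟ᴴ t
  ... | no s≢t   = no λ { (within _) → s≢t refl }
  ... | yes refl = map′ within (λ { (within ab) → ab }) (a ~? b)

  to-apex : ∀ {n} (a : X n) → Star _~_ a apex
  to-apex leaf           = ε
  to-apex centre         = from-centre refl ◅ ε
  to-apex (copy left a)  = Star.gmap (copy left) within (to-apex a)
  to-apex (copy right a) = Star.gmap (copy right) within (to-apex a) ◅◅ to-centre refl ◅ from-centre refl ◅ ε

  ~-connected : ∀ {n} (a b : X n) → Star _~_ a b
  ~-connected a b = to-apex a ◅◅ Star.reverse ~-sym (to-apex b)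

  any? : ∀ {n} {P : X n → Set} → Decidable P → Dec (∃ P)
  any? {zero}  P? = map′ (leaf ,_) (λ { (leaf , p) → p }) (P? leaf)
  any? {suc n} {P} P? = map′ fwd bwd
    (P? centre ⊎-dec (any? (P? ∘ copy left) ⊎-dec any? (P? ∘ copy right)))
    where
    fwd : P centre ⊎ ∃ (P ∘ copy left) ⊎ ∃ (P ∘ copy right) → ∃ P
    fwd (inj₁ p)              = centre , p
    fwd (inj₂ (inj₁ (a , p))) = copy left a , p
    fwd (inj₂ (inj₂ (a , p))) = copy right a , p
    bwd : ∃ P → P centre ⊎ ∃ (P ∘ copy left) ⊎ ∃ (P ∘ copy right)
    bwd (centre , p)       = inj₁ p
    bwd (copy left a , p)  = inj₂ (inj₁ (a , p))
    bwd (copy right a , p) = inj₂ (inj₂ (a , p))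

  -- The distance to the apex.
  height : ∀ {n} → X n → ℕ
  height leaf           = 0
  height centre         = 1
  height (copy left a)  = height a
  height (copy right a) = 2 + height a

  height-apex : ∀ n → height (apex {n}) ≡ 0
  height-apex zero    = refl
  height-apex (suc n) = height-apex n

  height≤0 : ∀ {n} (a : X n) → height a ≤ 0 → a ≡ apex
  height≤0 leaf          _ = refl
  height≤0 (copy left a) h = cong (copy left) (height≤0 a h)

  -- Height 0 belongs to the apex alone, and the apex is not adjacent to itself.
  apex-lowest : ∀ {n} {a m : X n} → a ~ m → m ≡ apex → ¬ height a ≤ height m
  apex-lowest {n} {a} am refl h =
    ~-irrefl apex (subst (_~ apex) (height≤0 a (≤-trans h (≤-reflexive (height-apex n)))) am)

  -- Such a neighbour is the parent of `m` when the tree hangs from its apex: for the centre it is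
  -- the apex of the left copy, for the apex of the right copy it is the centre, and elsewhere
  -- induction applies. The comparison is not strict because a maximum over a cycle gives no more.
  lower-neighbour-unique : ∀ {n} {a b m : X n} → a ~ m → b ~ m →
                           height a ≤ height m → height b ≤ height m → a ≡ b
  lower-neighbour-unique (within {s = left} am) (within bm) ha hb =
    cong (copy left) (lower-neighbour-unique am bm ha hb)
  lower-neighbour-unique (within {s = right} am) (within bm) ha hb =
    cong (copy right) (lower-neighbour-unique am bm (s≤s⁻¹ (s≤s⁻¹ ha)) (s≤s⁻¹ (s≤s⁻¹ hb)))
  lower-neighbour-unique {suc n} (within {s = left} am) (from-centre refl) ha hb =
    contradiction (≤-trans hb (≤-reflexive (height-apex n))) λ ()
  lower-neighbour-unique (within {s = right} am) (from-centre m≡apex) ha hb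
    = contradiction (s≤s⁻¹ (s≤s⁻¹ ha)) (apex-lowest am m≡apex)
  lower-neighbour-unique {suc n} (from-centre refl) (within {s = left} bm) ha hb =
    contradiction (≤-trans ha (≤-reflexive (height-apex n))) λ ()
  lower-neighbour-unique (from-centre m≡apex) (within {s = right} bm) ha hb
    = contradiction (s≤s⁻¹ (s≤s⁻¹ hb)) (apex-lowest bm m≡apex)
  lower-neighbour-unique (to-centre {s = left} refl)  (to-centre {s = left} refl)  ha hb = refl
  lower-neighbour-unique (to-centre {s = left} refl)  (to-centre {s = right} refl) ha hb = contradiction hb λ { (s≤s ()) }
  lower-neighbour-unique (to-centre {s = right} refl) (to-centre refl)             ha hb = contradiction ha λ { (s≤s ()) }
  lower-neighbour-unique (from-centre _) (from-centre _) ha hb = refl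

  -- In closed form `2 ^ n * (K + 1) - 1`, the total weight of `X n`. For `K = 1` it counts the
  -- vertices, and its two summands leave room for the left copy, and for the centre followed by the
  -- right copy.
  mass : ℕ → ℕ → ℕ
  mass K zero    = K
  mass K (suc n) = mass K n + suc (mass K n)

  order : ℕ → ℕ
  order = mass 1

  toFin : ∀ {n} → X n → Fin (order n)
  toFin leaf               = Fin.zero
  toFin {suc n} centre         = order n ↑ʳ Fin.zero
  toFin (copy left a)      = toFin a ↑ˡ _
  toFin {suc n} (copy right a) = order n ↑ʳ Fin.suc (toFin a)

  fromFin : ∀ n → Fin (order n) → X n
  fromFin zero    _ = leaf
  fromFin (suc n) v with splitAt (order n) v
  ... | inj₁ a           = copy left (fromFin n a)
  ... | inj₂ Fin.zero    = centre
  ... | inj₂ (Fin.suc a) = copy right (fromFin n a)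

  fromFin-toFin : ∀ {n} (a : X n) → fromFin n (toFin a) ≡ a
  fromFin-toFin leaf = refl
  fromFin-toFin {suc n} centre
    rewrite Fin.splitAt-↑ʳ (order n) (suc (order n)) Fin.zero = refl
  fromFin-toFin {suc n} (copy left a)
    rewrite Fin.splitAt-↑ˡ (order n) (toFin a) (suc (order n)) = cong (copy left) (fromFin-toFin a)
  fromFin-toFin {suc n} (copy right a)
    rewrite Fin.splitAt-↑ʳ (order n) (suc (order n)) (Fin.suc (toFin a)) = cong (copy right) (fromFin-toFin a)

  toFin-fromFin : ∀ n v → toFin (fromFin n v) ≡ v
  toFin-fromFin zero    Fin.zero = refl
  toFin-fromFin (suc n) v with splitAt (order n) v | Fin.join-splitAt (order n) (suc (order n)) v
  ... | inj₁ a           | eq = trans (cong (_↑ˡ suc (order n)) (toFin-fromFin n a)) eq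
  ... | inj₂ Fin.zero    | eq = eq
  ... | inj₂ (Fin.suc a) | eq = trans (cong ((order n ↑ʳ_) ∘ Fin.suc) (toFin-fromFin n a)) eq

  fromFin-injective : ∀ n {u v} → fromFin n u ≡ fromFin n v → u ≡ v
  fromFin-injective n {u} {v} eq =
    trans (sym (toFin-fromFin n u)) (trans (cong toFin eq) (toFin-fromFin n v))

  graph : ℕ → Graph
  graph n = record
    { order   = order n
    ; Adj     = λ u v → fromFin n u ~ fromFin n v
    ; adj?    = λ u v → fromFin n u ~? fromFin n v
    ; adj-sym = ~-sym
    ; adj-irr = λ v → ~-irrefl (fromFin n v)
    }

  toFin-~ : ∀ {n} {a b : X n} → a ~ b → Graph.Adj (graph n) (toFin a) (toFin b)
  toFin-~ = subst₂ _~_ (sym (fromFin-toFin _)) (sym (fromFin-toFin _))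

  graph-connected : ∀ n → Graph.Connected (graph n)
  graph-connected n u v = subst₂ (Star (Graph.Adj (graph n))) (toFin-fromFin n u) (toFin-fromFin n v)
    (Star.gmap toFin toFin-~ (~-connected (fromFin n u) (fromFin n v)))

  inject₁²≢suc² : ∀ {n} (j : Fin n) → Fin.inject₁ (Fin.inject₁ j) ≢ Fin.suc (Fin.suc j)
  inject₁²≢suc² j eq = m+1+n≢n 1 (sym (trans
    (sym (trans (Fin.toℕ-inject₁ (Fin.inject₁ j)) (Fin.toℕ-inject₁ j))) (cong Fin.toℕ eq)))

  -- A highest vertex of a cycle would have two lower neighbours.
  graph-acyclic : ∀ n → ¬ Graph.Cycle (graph n)
  graph-acyclic n (k , c , c-injective , step , close) = not-highest top highest
    where
    h : Fin (3 + k) → ℕ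
    h i = height (fromFin n (c i))
    top : Fin (3 + k)
    top = argmax h Fin.zero (List.tabulate id)
    highest : ∀ j → h j ≤ h top
    highest = All.tabulate⁻ (f[xs]≤f[argmax] {f = h} Fin.zero (List.tabulate id))
    not-between : ∀ i j m → i ≢ j → fromFin n (c i) ~ fromFin n (c m) → fromFin n (c j) ~ fromFin n (c m) →
                  ¬ (∀ j → h j ≤ h m)
    not-between i j m i≢j im jm high =
      i≢j (c-injective (fromFin-injective n (lower-neighbour-unique im jm (high i) (high j))))
    not-highest : ∀ i → ¬ (∀ j → h j ≤ h i)
    not-highest Fin.zero =
      not-between (Fin.suc Fin.zero) (Fin.fromℕ (2 + k)) Fin.zero (λ ()) (~-sym (step Fin.zero)) close
    not-highest (Fin.suc i) with view i
    ... | ‵fromℕ     =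
      not-between (Fin.inject₁ (Fin.fromℕ (1 + k))) Fin.zero _ (λ ()) (step (Fin.fromℕ (suc k))) (~-sym close)
    ... | ‵inject₁ j =
      not-between (Fin.inject₁ (Fin.inject₁ j)) (Fin.suc (Fin.suc j)) _ (inject₁²≢suc² j)
        (step (Fin.inject₁ j)) (~-sym (step (Fin.suc j)))

  mass-nonZero : ∀ k n → NonZero (mass (suc k) n)
  mass-nonZero k zero    = _
  mass-nonZero k (suc n) = ≢-nonZero λ eq → contradiction (m+n≡0⇒n≡0 (mass (suc k) n) eq) λ ()

  shape : ℕ → Tree
  shape n = record
    { graph     = graph n
    ; nonEmpty  = mass-nonZero 0 n
    ; connected = graph-connected n
    ; acyclic   = graph-acyclic n
    }

-- Copies of `X n` inside a fixed tree: centroid trees, a cheap tree, and the lower bound.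

module ShapeCopies where
  open Subgraphs
  open SearchTrees
  open Shapes using (Hand; left; right; _≟ᴴ_; X; leaf; centre; copy; apex; _~_; within; to-centre; from-centre;
    ~-connected; any?; mass)
  open import Data.Fin.Subset
  open import Data.Fin.Subset.Properties
  open import Data.Nat.Base using (ℕ; zero; suc; _+_; _*_; _≤_; z≤n; s≤s)
  open import Data.Nat.Properties
  open import Relation.Binary.Construct.Closure.ReflexiveTransitive using (ε)

  weightX : ℕ → ∀ {n} → X n → ℕ
  weightX K leaf       = K
  weightX K centre     = 1
  weightX K (copy s a) = weightX K a

  opposite : Hand → Hand
  opposite left  = right
  opposite right = left

  ≢⇒opposite : ∀ {s t} → s ≢ t → opposite s ≡ t
  ≢⇒opposite {left}  {left}  s≢t = contradiction refl s≢t
  ≢⇒opposite {left}  {right} s≢t = refl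
  ≢⇒opposite {right} {left}  s≢t = refl
  ≢⇒opposite {right} {right} s≢t = contradiction refl s≢t

  opposite≢ : ∀ s → opposite s ≢ s
  opposite≢ left  ()
  opposite≢ right ()

  copy-injectiveˡ : ∀ {n s t} {a b : X n} → copy s a ≡ copy t b → s ≡ t
  copy-injectiveˡ refl = refl

  centroidCost : ℕ → ℕ → ℕ
  centroidCost K zero    = K
  centroidCost K (suc n) = mass K (suc n) + 2 * centroidCost K n

  -- To be compared with twice the cost of a search tree, so that a gain of half the weight per
  -- halving needs no fraction. The recurrence is that of `centroidCost`, started at 0 instead of
  -- `K`.
  lowerBound : ℕ → ℕ → ℕ
  lowerBound K zero    = 0
  lowerBound K (suc n) = 2 * lowerBound K n + mass K (suc n)

  -- The summand `mass K n` pays for moving the right half down one level; 3 is the depth of the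
  -- centre, which lies below the apexes of both halves.
  upperBound : ℕ → ℕ → ℕ
  upperBound K zero    = K
  upperBound K (suc n) = 2 * upperBound K n + mass K n + 3

  module Copies (I : Instance) (w : Fin (Instance.order I) → ℕ) (K : ℕ) where
    open Instance I using (tree; graph; order; Vertex; Adj; AdjIn; ReachableIn; IsComponent)
    open Components graph
    open Trees I w

    -- The halves of a copy are copies in the same ambient tree. Inductions on `n` therefore never
    -- transport search trees between graphs. By `adj⁻` a copy is an induced subgraph.
    record Copy {n} (e : X n → Vertex) : Set where
      field
        injective : ∀ {a b} → e a ≡ e b → a ≡ b
        adj⁺      : ∀ {a b} → a ~ b → Adj (e a) (e b)
        adj⁻      : ∀ {a b} → Adj (e a) (e b) → a ~ b
        weight    : ∀ a → w (e a) ≡ weightX K a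
    open Copy

    copy-half : ∀ {n} {e : X (suc n) → Vertex} s → Copy e → Copy (e ∘ copy s)
    copy-half s C = record
      { injective = λ eq → case (injective C eq) of λ { refl → refl }
      ; adj⁺      = adj⁺ C ∘ within
      ; adj⁻      = λ ab → case (adj⁻ C ab) of λ { (within ab) → ab }
      ; weight    = weight C ∘ copy s
      }

    module _ {n} (e : X n → Vertex) where
      abstract
        image : Subset order
        image = comprehension {P = λ v → ∃[ a ] e a ≡ v} λ v → any? λ a → e a Fin.≟ v

        ∈-image⁺ : ∀ a → e a ∈ image
        ∈-image⁺ a = from (∈-comprehension λ v → any? λ a → e a Fin.≟ v) (a , refl)

        ∈-image⁻ : ∀ {v} → v ∈ image → ∃[ a ] e a ≡ v
        ∈-image⁻ = to (∈-comprehension λ v → any? λ a → e a Fin.≟ v)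

    connected : ∀ {n} {e : X n → Vertex} {S} → Copy e → (∀ a → e a ∈ S) → ∀ a b → ReachableIn S (e a) (e b)
    connected {e = e} C e∈S a b = Star.gmap e (λ ab → e∈S _ , e∈S _ , adj⁺ C ab) (~-connected a b)

    image-leaf : (e : X 0 → Vertex) → ⁅ e leaf ⁆ ≡ image e
    image-leaf e = ⇔⇒≡ λ v → mk⇔
      (λ v∈ → subst (_∈ image e) (sym (x∈⁅y⁆⇒x≡y _ v∈)) (∈-image⁺ e leaf))
      (λ v∈ → case (∈-image⁻ e v∈) of λ { (leaf , refl) → x∈⁅x⁆ _ })

    module Halves {n} {e : X (suc n) → Vertex} (C : Copy e) where
      half : Hand → Subset order
      half s = image (e ∘ copy s)

      half⁺ : ∀ s a → e (copy s a) ∈ half s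
      half⁺ s = ∈-image⁺ (e ∘ copy s)

      half⁻ : ∀ s {v} → v ∈ half s → ∃[ a ] e (copy s a) ≡ v
      half⁻ s = ∈-image⁻ (e ∘ copy s)

      half⊆image : ∀ s → half s ⊆ image e
      half⊆image s v∈ = case (half⁻ s v∈) of λ { (a , refl) → ∈-image⁺ e (copy s a) }

      centre∉half : ∀ s → e centre ∉ half s
      centre∉half s c∈ with half⁻ s c∈
      ... | a , eq with () ← injective C {copy s a} {centre} eq

      half-hand : ∀ {s t a} → e (copy t a) ∈ half s → t ≡ s
      half-hand {s} {t} {a} v∈ with half⁻ s v∈
      ... | b , eq with refl ← injective C {copy s b} {copy t a} eq = refl

      halves-disjoint : ∀ {s t} → s ≢ t → Disjoint (half s) (half t)
      halves-disjoint {s} s≢t v∈s v∈t with half⁻ s v∈s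
      ... | a , refl = s≢t (half-hand v∈t)

      image≡∪ : half left ∪ (half right ∪ ⁅ e centre ⁆) ≡ image e
      image≡∪ = ⇔⇒≡ λ v → mk⇔ fwd bwd
        where
        fwd : ∀ {v} → v ∈ half left ∪ (half right ∪ ⁅ e centre ⁆) → v ∈ image e
        fwd v∈ with x∈p∪q⁻ (half left) _ v∈
        ... | inj₁ v∈l = half⊆image left v∈l
        ... | inj₂ v∈′ with x∈p∪q⁻ (half right) _ v∈′
        ...   | inj₁ v∈r = half⊆image right v∈r
        ...   | inj₂ v∈c rewrite x∈⁅y⁆⇒x≡y _ v∈c = ∈-image⁺ e centre
        bwd : ∀ {v} → v ∈ image e → v ∈ half left ∪ (half right ∪ ⁅ e centre ⁆)
        bwd v∈ with ∈-image⁻ e v∈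
        ... | centre , refl       = x∈p∪q⁺ (inj₂ (x∈p∪q⁺ (inj₂ (x∈⁅x⁆ _))))
        ... | copy left a , refl  = x∈p∪q⁺ (inj₁ (half⁺ left a))
        ... | copy right a , refl = x∈p∪q⁺ (inj₂ (x∈p∪q⁺ (inj₁ (half⁺ right a))))

      right#centre : Disjoint (half right) ⁅ e centre ⁆
      right#centre v∈r v∈c rewrite x∈⁅y⁆⇒x≡y _ v∈c = centre∉half right v∈r

      left#rest : Disjoint (half left) (half right ∪ ⁅ e centre ⁆)
      left#rest v∈l v∈ with x∈p∪q⁻ (half right) _ v∈
      ... | inj₁ v∈r = halves-disjoint (λ ()) v∈l v∈r
      ... | inj₂ v∈c rewrite x∈⁅y⁆⇒x≡y _ v∈c = centre∉half left v∈l

      edge-to-centre : ∀ s {x y} → x ∈ half s → y ∈ ⁅ e centre ⁆ → Adj x y → x ≡ e (copy s apex)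
      edge-to-centre s x∈ y∈ xy with half⁻ s x∈ | x∈⁅y⁆⇒x≡y _ y∈
      ... | a , refl | refl with to-centre refl ← adj⁻ C xy = refl

      edge-to-rest : ∀ {x y} → x ∈ half left → y ∈ half right ∪ ⁅ e centre ⁆ → Adj x y → x ≡ e (copy left apex)
      edge-to-rest x∈ y∈ xy with x∈p∪q⁻ (half right) _ y∈
      ... | inj₂ y∈c = edge-to-centre left x∈ y∈c xy
      ... | inj₁ y∈r with half⁻ left x∈ | half⁻ right y∈r
      ...   | a , refl | b , refl with () ← adj⁻ C xy

      rest-connected : ∀ {v} → v ∈ half right ∪ ⁅ e centre ⁆ →
                       ReachableIn (half right ∪ ⁅ e centre ⁆) (e centre) v
      rest-connected v∈ with x∈p∪q⁻ (half right) _ v∈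
      ... | inj₂ v∈c with refl ← x∈⁅y⁆⇒x≡y _ v∈c = ε
      ... | inj₁ v∈r with a , refl ← half⁻ right v∈r =
        (x∈p∪q⁺ (inj₂ (x∈⁅x⁆ _)) , half∈ apex , adj⁺ C (from-centre refl))
        ◅ connected (copy-half right C) half∈ apex a
        where
        half∈ : ∀ a → e (copy right a) ∈ half right ∪ ⁅ e centre ⁆
        half∈ a = x∈p∪q⁺ (inj₁ (half⁺ right a))

    wt-image : ∀ {n} {e : X n → Vertex} → Copy e → wt w (image e) ≡ mass K n
    wt-image {zero}  {e} C = trans (cong (wt w) (sym (image-leaf e))) (trans (wt-⁅⁆ w _) (weight C leaf))
    wt-image {suc n} {e} C = begin
      wt w (image e)                                        ≡⟨ cong (wt w) image≡∪ ⟨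
      wt w (half left ∪ (half right ∪ ⁅ e centre ⁆))        ≡⟨ wt-∪ w left#rest ⟩
      wt w (half left) + wt w (half right ∪ ⁅ e centre ⁆)   ≡⟨ cong (wt w (half left) +_) (wt-∪ w right#centre) ⟩
      wt w (half left) + (wt w (half right) + wt w ⁅ e centre ⁆)
        ≡⟨ cong₂ _+_ (wt-image (copy-half left C))
             (cong₂ _+_ (wt-image (copy-half right C)) (trans (wt-⁅⁆ w _) (weight C centre))) ⟩
      mass K n + (mass K n + 1)                             ≡⟨ cong (mass K n +_) (+-comm (mass K n) 1) ⟩
      mass K n + suc (mass K n)                             ∎
      where
      open ≡-Reasoning
      open Halves C

    module _ {n} {e : X (suc n) → Vertex} (C : Copy e) where
      open Halves C

      half-component : ∀ s → IsComponent (image e - e centre) (half s)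
      half-component s = isComponent (half⁺ s apex) ⊆S
          (λ u∈ → case (half⁻ s u∈) of λ { (a , refl) →
            connected (copy-half s C) (λ b → ⊆S (half⁺ s b)) apex a })
          closed
        where
        ⊆S : half s ⊆ image e - e centre
        ⊆S v∈ = x∈p∧x≢y⇒x∈p-y (half⊆image s v∈) λ { refl → centre∉half s v∈ }
        closed : ∀ {x y} → AdjIn (image e - e centre) x y → x ∈ half s → y ∈ half s
        closed (_ , y∈ , xy) x∈ with half⁻ s x∈ | ∈-image⁻ e (x∈p-y⇒x∈p (image e) y∈)
        ... | a , refl | centre , refl = contradiction refl (x∈p-y⇒x≢y (image e) y∈)
        ... | a , refl | copy t b , refl with adj⁻ C xy
        ...   | within _ = half⁺ s b

      centre-components : ∀ {Hs} → Unique Hs → (∀ H → H List.∈ Hs ⇔ IsComponent (image e - e centre) H) →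
                          Hs ↭ half left ∷ half right ∷ []
      centre-components uniq Hs⇔ = same-members⇒↭ uniq ((l≢r ∷ []) ∷ [] ∷ [])
        λ H → mk⇔ (fwd ∘ to (Hs⇔ H)) (from (Hs⇔ H) ∘ bwd)
        where
        l≢r : half left ≢ half right
        l≢r eq with () ← half-hand {right} (subst (e (copy left apex) ∈_) eq (half⁺ left apex))
        fwd : ∀ {H} → IsComponent (image e - e centre) H → H List.∈ half left ∷ half right ∷ []
        fwd c@(v , v∈ , H⇔) with ∈-image⁻ e (x∈p-y⇒x∈p (image e) v∈)
        ... | centre , refl = contradiction refl (x∈p-y⇒x≢y (image e) v∈)
        ... | copy left a , refl  = here (component-unique c (half-component left) (from (H⇔ v) ε) (half⁺ left a))
        ... | copy right a , refl = there (here (component-unique c (half-component right) (from (H⇔ v) ε) (half⁺ right a)))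
        bwd : ∀ {H} → H List.∈ half left ∷ half right ∷ [] → IsComponent (image e - e centre) H
        bwd (here refl)         = half-component left
        bwd (there (here refl)) = half-component right

      -- Removing any other vertex leaves the centre together with the opposite half, which is more
      -- than half of the mass.
      centroid-is-centre : ∀ {r} → r ∈ image e →
        (∀ H → IsComponent (image e - r) H → 2 * wt w H ≤ wt w (image e)) → r ≡ e centre
      centroid-is-centre r∈ halved with ∈-image⁻ e r∈
      ... | centre , refl = refl
      ... | copy s a , refl = contradiction too-heavy (<⇒≱ (n<1+n _))
        where
        r = e (copy s a)
        S′ = image e - r
        H = component S′ (e centre)
        ∈S′ : ∀ {b} → b ≢ copy s a → e b ∈ S′
        ∈S′ {b} b≢ = x∈p∧x≢y⇒x∈p-y (∈-image⁺ e b) (b≢ ∘ injective C)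
        opposite∈S′ : ∀ b → e (copy (opposite s) b) ∈ S′
        opposite∈S′ b = ∈S′ (opposite≢ s ∘ copy-injectiveˡ)
        cover : ∀ {v} → v ∈ image e → v ∈ half s ⊎ v ∈ H
        cover v∈ with ∈-image⁻ e v∈
        ... | centre , refl = inj₂ (from ∈-component ε)
        ... | copy t b , refl with s ≟ᴴ t
        ...   | yes refl = inj₁ (half⁺ s b)
        ...   | no s≢t with refl ← ≢⇒opposite s≢t = inj₂ (from ∈-component
                ((∈S′ (λ ()) , opposite∈S′ apex , adj⁺ C (from-centre refl))
                 ◅ connected (copy-half (opposite s) C) opposite∈S′ apex b))
        -- Let `m = mass K n` and `M = mass K (suc n)`. The copy is covered by `half s` and `H`; if
        -- `H` had at most half the weight, then `2 * M ≤ 2 * m + M`, and the right side is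
        -- `2 * M - 1`. The missing 1 is the weight of the centre.
        too-heavy : suc (2 * mass K (suc n)) ≤ 2 * mass K (suc n)
        too-heavy = begin
          suc (2 * mass K (suc n))                       ≡⟨ cong (suc ∘ (2 *_)) (wt-image C) ⟨
          suc (2 * wt w (image e))                       ≤⟨ s≤s (*-monoʳ-≤ 2 (wt-⊆∪ w cover)) ⟩
          suc (2 * (wt w (half s) + wt w H))             ≡⟨ cong suc (*-distribˡ-+ 2 (wt w (half s)) (wt w H)) ⟩
          suc (2 * wt w (half s) + 2 * wt w H)           ≤⟨ s≤s (+-monoʳ-≤ (2 * wt w (half s))
                                                               (halved H (component-isComponent (∈S′ λ ())))) ⟩
          suc (2 * wt w (half s) + wt w (image e))       ≡⟨ cong₂ (λ x y → suc (2 * x + y)) (wt-image (copy-half s C)) (wt-image C) ⟩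
          suc (2 * mass K n + mass K (suc n))            ≡⟨ regroup (mass K n) ⟩
          2 * mass K (suc n)                             ∎
          where
          open ≤-Reasoning
          regroup : ∀ m → suc (2 * m + (m + suc m)) ≡ 2 * (m + suc m)
          regroup = solve-∀

    leaf-no-components : ∀ (e : X 0 → Vertex) {r H} → r ∈ image e → ¬ IsComponent (image e - r) H
    leaf-no-components e r∈ (v , v∈ , _) with ∈-image⁻ e r∈ | ∈-image⁻ e (x∈p-y⇒x∈p (image e) v∈)
    ... | leaf , refl | leaf , refl = x∈p-y⇒x≢y (image e) v∈ refl

    module _ (halved : ∀ {S r} → IsCentroid I S r → ∀ H → IsComponent (S - r) H → 2 * wt w H ≤ wt w S) where

      -- Every root is forced to be the centre of its copy, so centroid trees differ only in the
      -- order of their children and the cost is exact.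
      cst-centroid : ∀ {n} {e : X n → Vertex} → Copy e → (T : SearchTreeOn tree (image e)) →
                     AllCentroids I T → cst T ≡ centroidCost K n
      cst-centroid {zero} C (node r r∈ []      _ _   []) _ = trans (+-identityʳ _) (wt-image C)
      cst-centroid {zero} {e} C (node r r∈ (H ∷ _) _ Hs⇔ _)  _ =
        contradiction (to (Hs⇔ H) (here refl)) (leaf-no-components e r∈)
      cst-centroid {suc n} {e} C (node r r∈ Hs uniq Hs⇔ ts) (c , cs) =
        split (permute (centre-components C uniq λ H →
          subst (λ v → H List.∈ Hs ⇔ IsComponent (image e - v) H) r≡ (Hs⇔ H)) ts)
        where
        open Halves C
        r≡ : r ≡ e centre
        r≡ = centroid-is-centre C r∈ (halved c)
        split : (Σ[ ts′ ∈ All (SearchTreeOn tree) (half left ∷ half right ∷ []) ]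
                  cstAll ts′ ≡ cstAll ts × (AllCentroidsAll I ts → AllCentroidsAll I ts′)) →
                wt w (image e) + cstAll ts ≡ centroidCost K (suc n)
        split (tₗ ∷ tᵣ ∷ [] , eq , cen) = cong₂ _+_ (wt-image C) (trans (sym eq)
          (cong₂ (λ x y → x + (y + 0)) (cst-centroid (copy-half left C) tₗ (proj₁ (cen cs)))
                                        (cst-centroid (copy-half right C) tᵣ (proj₁ (proj₂ (cen cs))))))

    -- The two halves are searched in the same way, the centre hanging below the apex of the right half.
    apexTree : ∀ {n} {e : X n → Vertex} → Copy e →
               Σ[ T ∈ SearchTreeOn tree (image e) ] root T ≡ e apex × cst T ≡ upperBound K n
    apexTree {zero} {e} C with T , rt , eq ← singleton (e leaf) =
      subst (λ S → Σ[ T ∈ SearchTreeOn tree S ] root T ≡ e leaf × cst T ≡ K) (image-leaf e)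
        (T , rt , trans eq (weight C leaf))
    apexTree {suc n} {e} C
      with Tₗ , rₗ , eqₗ ← apexTree (copy-half left C)
      with Tᵣ , rᵣ , eqᵣ ← apexTree (copy-half right C)
      with Tc , _ , eqc ← singleton (e centre)
      -- The only edge from the right half to the centre starts at the root of `Tᵣ`, as `addBranch`
      -- demands. The next step uses the same fact for the left half and everything else.
      with T₁ , rt₁ , eq₁ ← addBranch Tᵣ Tc (Halves.right#centre C) (x∈⁅x⁆ (e centre))
             (λ v∈ → case (x∈⁅y⁆⇒x≡y _ v∈) of λ { refl → ε })
             (λ x∈ y∈ xy → trans (Halves.edge-to-centre C right x∈ y∈ xy) (sym rᵣ))
      with T₂ , rt₂ , eq₂ ← addBranch Tₗ T₁ (Halves.left#rest C) (x∈p∪q⁺ (inj₂ (x∈⁅x⁆ (e centre))))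
             (Halves.rest-connected C) (λ x∈ y∈ xy → trans (Halves.edge-to-rest C x∈ y∈ xy) (sym rₗ))
      = subst (λ S → Σ[ T ∈ SearchTreeOn tree S ] root T ≡ e apex × cst T ≡ upperBound K (suc n)) (Halves.image≡∪ C)
          (T₂ , trans rt₂ rₗ , (begin
            cst T₂
              ≡⟨ trans eq₂ (cong (λ x → cst Tₗ + (wt w (Halves.half C right ∪ ⁅ e centre ⁆) + x)) eq₁) ⟩
            cst Tₗ + (wt w (Halves.half C right ∪ ⁅ e centre ⁆) + (cst Tᵣ + (wt w ⁅ e centre ⁆ + cst Tc)))
              ≡⟨ cong₂ (λ x y → cst Tₗ + (x + (cst Tᵣ + (y + cst Tc))))
                   (wt-∪ w (Halves.right#centre C)) wt-centre ⟩
            cst Tₗ + (wt w (Halves.half C right) + wt w ⁅ e centre ⁆ + (cst Tᵣ + (1 + cst Tc)))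
              ≡⟨ cong₂ (λ x y → cst Tₗ + (x + y + (cst Tᵣ + (1 + cst Tc))))
                   (wt-image (copy-half right C)) wt-centre ⟩
            cst Tₗ + (mass K n + 1 + (cst Tᵣ + (1 + cst Tc)))
              ≡⟨ cong₂ (λ x y → x + (mass K n + 1 + y)) eqₗ
                   (cong₂ (λ x y → x + (1 + y)) eqᵣ (trans eqc (weight C centre))) ⟩
            upperBound K n + (mass K n + 1 + (upperBound K n + 2))
              ≡⟨ regroup (upperBound K n) (mass K n) ⟩
            upperBound K (suc n)
              ∎))
      where
      open ≡-Reasoning
      wt-centre : wt w ⁅ e centre ⁆ ≡ 1
      wt-centre = trans (wt-⁅⁆ w _) (weight C centre)
      regroup : ∀ u m → u + (m + 1 + (u + 2)) ≡ 2 * u + m + 3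
      regroup = solve-∀


    charge : ∀ {A : Set} → Dec A → ℕ → ℕ
    charge (yes _) k = k
    charge (no _)  k = 0

    -- Each vertex of H is charged for its ancestors in H only.
    mutual
      restricted : ∀ {S} → SearchTreeOn tree S → Subset order → ℕ
      restricted {S} (node r _ _ _ _ ts) H = charge (r ∈? H) (wt w (S ∩ H)) + restrictedAll ts H

      restrictedAll : ∀ {Hs} → All (SearchTreeOn tree) Hs → Subset order → ℕ
      restrictedAll []       H = 0
      restrictedAll (t ∷ ts) H = restricted t H + restrictedAll ts H

    mutual
      restricted≤cst : ∀ {S} (T : SearchTreeOn tree S) H → restricted T H ≤ cst T
      restricted≤cst {S} (node r _ _ _ _ ts) H with r ∈? H
      ... | yes _ = +-mono-≤ (wt-mono w (p∩q⊆p S H)) (restrictedAll≤cstAll ts H)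
      ... | no _  = +-mono-≤ z≤n (restrictedAll≤cstAll ts H)

      restrictedAll≤cstAll : ∀ {Hs} (ts : All (SearchTreeOn tree) Hs) H → restrictedAll ts H ≤ cstAll ts
      restrictedAll≤cstAll []       H = z≤n
      restrictedAll≤cstAll (t ∷ ts) H = +-mono-≤ (restricted≤cst t H) (restrictedAll≤cstAll ts H)

    +-interchange : ∀ a b c d → (a + b) + (c + d) ≡ (a + c) + (b + d)
    +-interchange = solve-∀

    module _ {A B H : Subset order} (A#B : Disjoint A B) (A⊆H : A ⊆ H) (B⊆H : B ⊆ H) where

      -- As `A` and `B` are disjoint, `r` is charged for at most one of them; it then lies in `H`
      -- too and is charged there for a larger set.
      charge-superadditive : ∀ S r → charge (r ∈? A) (wt w (S ∩ A)) + charge (r ∈? B) (wt w (S ∩ B))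
                                     ≤ charge (r ∈? H) (wt w (S ∩ H))
      charge-superadditive S r with r ∈? A | r ∈? B | r ∈? H
      ... | yes r∈A | yes r∈B | _       = contradiction r∈B (A#B r∈A)
      ... | yes r∈A | no _    | no r∉H = contradiction (A⊆H r∈A) r∉H
      ... | no _    | yes r∈B | no r∉H = contradiction (B⊆H r∈B) r∉H
      ... | no _    | no _    | _       = z≤n
      ... | no _    | yes _   | yes _   = wt-mono w λ x∈ → let x∈S , x∈B = x∈p∩q⁻ S B x∈ in x∈p∩q⁺ (x∈S , B⊆H x∈B)
      ... | yes _   | no _    | yes _   = ≤-trans (≤-reflexive (+-identityʳ _))
        (wt-mono w λ x∈ → let x∈S , x∈A = x∈p∩q⁻ S A x∈ in x∈p∩q⁺ (x∈S , A⊆H x∈A))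

      mutual
        restricted-superadditive : ∀ {S} (T : SearchTreeOn tree S) → restricted T A + restricted T B ≤ restricted T H
        restricted-superadditive {S} (node r _ _ _ _ ts) = ≤-trans
          (≤-reflexive (+-interchange (charge (r ∈? A) _) (restrictedAll ts A)
                                      (charge (r ∈? B) _) (restrictedAll ts B)))
          (+-mono-≤ (charge-superadditive S r) (restrictedAll-superadditive ts))

        restrictedAll-superadditive : ∀ {Hs} (ts : All (SearchTreeOn tree) Hs) →
                                      restrictedAll ts A + restrictedAll ts B ≤ restrictedAll ts H
        restrictedAll-superadditive []       = z≤n
        restrictedAll-superadditive (t ∷ ts) = ≤-trans
          (≤-reflexive (+-interchange (restricted t A) (restrictedAll ts A) (restricted t B) (restrictedAll ts B)))
          (+-mono-≤ (restricted-superadditive t) (restrictedAll-superadditive ts))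

    module _ {n} {e : X (suc n) → Vertex} (C : Copy e) where
      open Halves C

      private
        E L R : Subset order
        E = image e
        L = half left
        R = half right
        M = mass K (suc n)

      charge-halves : ∀ S r → charge (r ∈? L) (wt w (S ∩ L)) + charge (r ∈? R) (wt w (S ∩ R)) ≤ mass K n
      charge-halves S r with r ∈? L | r ∈? R
      ... | yes r∈L | yes r∈R = contradiction r∈R (halves-disjoint (λ ()) r∈L)
      ... | no _    | no _    = z≤n
      ... | yes _   | no _    = ≤-trans (≤-reflexive (+-identityʳ _))
        (≤-trans (wt-mono w (p∩q⊆q S L)) (≤-reflexive (wt-image (copy-half left C))))
      ... | no _    | yes _   =
        ≤-trans (wt-mono w (p∩q⊆q S R)) (≤-reflexive (wt-image (copy-half right C)))

      -- The copy is charged `k`, its halves `l` and `r`, and the surplus is at least `M / 2`;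
      -- everything is doubled to stay in the natural numbers. As a record, unlike a bare
      -- inequality, it determines `l`, `r` and `k`.
      record Separated (l r k : ℕ) : Set where
        constructor separated
        field separation : 2 * (l + r) + M ≤ 2 * k
      open Separated public

      -- The first vertex of a copy that the search tree meets is an ancestor of the whole copy, but
      -- belongs to at most one of its halves.
      charge-image : ∀ {S r} → E ⊆ S → r ∈ E →
        Separated (charge (r ∈? L) (wt w (S ∩ L))) (charge (r ∈? R) (wt w (S ∩ R)))
                  (charge (r ∈? E) (wt w (S ∩ E)))
      charge-image {S} {r} E⊆S r∈E with r ∈? E
      ... | no r∉E = contradiction r∈E r∉E
      ... | yes _   = separated (begin
        -- The halves receive at most `mass K n` together and the copy receives `M`. The surplus
        -- `mass K n + 1` exceeds `M / 2`.
        2 * (charge (r ∈? L) (wt w (S ∩ L)) + charge (r ∈? R) (wt w (S ∩ R))) + M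
                               ≤⟨ +-monoˡ-≤ M (*-monoʳ-≤ 2 (charge-halves S r)) ⟩
        2 * mass K n + M       ≤⟨ n≤1+n _ ⟩
        suc (2 * mass K n + M) ≡⟨ regroup (mass K n) ⟩
        2 * M                  ≡⟨ cong (2 *_) (wt-image C) ⟨
        2 * wt w E             ≤⟨ *-monoʳ-≤ 2 (wt-mono w λ x∈E → x∈p∩q⁺ (E⊆S x∈E , x∈E)) ⟩
        2 * wt w (S ∩ E)       ∎)
        where
        open ≤-Reasoning
        regroup : ∀ m → suc (2 * m + (m + suc m)) ≡ 2 * (m + suc m)
        regroup = solve-∀

      separated-+ : ∀ {l l′ r r′ k k′} → Separated l r k → l′ + r′ ≤ k′ → Separated (l + l′) (r + r′) (k + k′)
      separated-+ {l} {l′} {r} {r′} {k} {k′} (separated sep) le = separated (begin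
        2 * ((l + l′) + (r + r′)) + M          ≡⟨ regroup l l′ r r′ M ⟩
        2 * (l + r) + M + 2 * (l′ + r′)        ≤⟨ +-mono-≤ sep (*-monoʳ-≤ 2 le) ⟩
        2 * k + 2 * k′                         ≡⟨ *-distribˡ-+ 2 k k′ ⟨
        2 * (k + k′)                           ∎)
        where
        open ≤-Reasoning
        regroup : ∀ a b c d m → 2 * ((a + b) + (c + d)) + m ≡ 2 * (a + c) + m + 2 * (b + d)
        regroup = solve-∀

      +-separated : ∀ {l l′ r r′ k k′} → l + r ≤ k → Separated l′ r′ k′ → Separated (l + l′) (r + r′) (k + k′)
      +-separated {l} {l′} {r} {r′} {k} {k′} le sep
        rewrite +-comm l l′ | +-comm r r′ | +-comm k k′ = separated-+ sep le

      mutual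
        -- While the roots avoid `E`, the connected set `E` stays inside one child, and the
        -- recursion follows it. The first root in `E` yields the surplus of `charge-image`; for all
        -- other vertices superadditivity ensures that nothing is lost.
        restricted-separated : ∀ {S} → E ⊆ S → (T : SearchTreeOn tree S) →
                               Separated (restricted T L) (restricted T R) (restricted T E)
        restricted-separated {S} E⊆S (node r r∈S Hs uniq Hs⇔ ts) = split (r ∈? E)
          where
          T = node r r∈S Hs uniq Hs⇔ ts
          halves-superadditive = restrictedAll-superadditive
            (halves-disjoint λ ()) (half⊆image left) (half⊆image right) ts
          split : Dec (r ∈ E) → Separated (restricted T L) (restricted T R) (restricted T E)
          split (yes r∈E) = separated-+ (charge-image E⊆S r∈E) halves-superadditive
          split (no r∉E)  = +-separated
            (charge-superadditive (halves-disjoint λ ()) (half⊆image left) (half⊆image right) S r)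
            -- `E` is connected and misses `r`, so it lies in the component of its centre.
            (restrictedAll-separated (from (Hs⇔ _) (component-isComponent (E⊆S-r centre)))
              E⊆component ts)
            where
            E⊆S-r : ∀ a → e a ∈ S - r
            E⊆S-r a = x∈p∧x≢y⇒x∈p-y (E⊆S (∈-image⁺ e a)) λ { refl → r∉E (∈-image⁺ e a) }
            E⊆component : E ⊆ component (S - r) (e centre)
            E⊆component x∈E with a , refl ← ∈-image⁻ e x∈E = from ∈-component (connected C E⊆S-r centre a)

        restrictedAll-separated : ∀ {H Hs} → H List.∈ Hs → E ⊆ H → (ts : All (SearchTreeOn tree) Hs) →
          Separated (restrictedAll ts L) (restrictedAll ts R) (restrictedAll ts E)
        restrictedAll-separated (here refl) E⊆H (t ∷ ts) = separated-+ (restricted-separated E⊆H t)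
          (restrictedAll-superadditive (halves-disjoint λ ()) (half⊆image left) (half⊆image right) ts)
        restrictedAll-separated (there H∈) E⊆H (t ∷ ts) = +-separated
          (restricted-superadditive (halves-disjoint λ ()) (half⊆image left) (half⊆image right) t)
          (restrictedAll-separated H∈ E⊆H ts)

    -- The induction keeps `T` and shrinks the copy to a half, hence the arbitrary `S` around the
    -- copy. Restricted costs take the place of search trees of the halves.
    lowerBound≤restricted : ∀ {n} {e : X n → Vertex} → Copy e → ∀ {S} → image e ⊆ S →
                            (T : SearchTreeOn tree S) → lowerBound K n ≤ 2 * restricted T (image e)
    lowerBound≤restricted {zero}      C E⊆S T = z≤n
    lowerBound≤restricted {suc n} {e} C E⊆S T = begin
      2 * lowerBound K n + mass K (suc n)
        ≤⟨ +-monoˡ-≤ _ (+-mono-≤ (IH left) (≤-trans (≤-reflexive (+-identityʳ _)) (IH right))) ⟩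
      2 * restricted T (half left) + 2 * restricted T (half right) + mass K (suc n)
        ≡⟨ cong (_+ mass K (suc n)) (*-distribˡ-+ 2 (restricted T (half left)) _) ⟨
      2 * (restricted T (half left) + restricted T (half right)) + mass K (suc n)
        ≤⟨ separation (restricted-separated C E⊆S T) ⟩
      2 * restricted T (image e)
        ∎
      where
      open ≤-Reasoning
      open Halves C
      IH : ∀ s → lowerBound K n ≤ 2 * restricted T (half s)
      IH s = lowerBound≤restricted (copy-half s C) (E⊆S ∘ half⊆image s) T

    lowerBound≤cst : ∀ {n} {e : X n → Vertex} → Copy e → (T : SearchTreeOn tree (image e)) →
                     lowerBound K n ≤ 2 * cst T
    lowerBound≤cst C T = ≤-trans (lowerBound≤restricted C id T) (*-monoʳ-≤ 2 (restricted≤cst T _))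

-- Solving the recurrences.

module Arithmetic where
  open ShapeCopies using (centroidCost; lowerBound; upperBound)
  open Shapes using (mass)
  open import Data.Integer.Base as ℤ using (+_; +≤+)
  import Data.Integer.Properties as ℤ
  open import Data.Nat.Base using (zero; suc; _+_; _*_; _^_; _≤_; z≤n; s≤s; NonZero)
  open import Data.Nat.Properties
  open import Data.Rational.Base using (0ℚ; 1ℚ; toℚᵘ; ↥_; ↧ₙ_)
  open import Data.Rational.Unnormalised.Base as ℚᵘ using (mkℚᵘ; *≡*; *≤*)
  import Data.Rational.Unnormalised.Properties as ℚᵘ

  -- The successor of the mass doubles at each step, so it equals `2 ^ n * (k + 2)`, and
  -- `k + 2 ≤ 2 * (k + 1)`.
  mass-suc : ∀ k n → suc (mass (suc k) n) ≤ 2 * (2 ^ n * suc k)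
  mass-suc k zero    = s≤s (≤-trans (≤-reflexive (sym (+-identityʳ _)))
    (≤-trans (m≤n+m _ k) (≤-reflexive (regroup k))))
    where
    regroup : ∀ k → k + (suc k + 0) ≡ (k + 0) + suc (k + 0 + 0)
    regroup = solve-∀
  mass-suc k (suc n) = begin
    suc (m + suc m)                  ≡⟨ cong suc (+-suc m m) ⟩
    suc (suc (m + m))                ≡⟨ regroup m ⟩
    2 * suc m                        ≤⟨ *-monoʳ-≤ 2 (mass-suc k n) ⟩
    2 * (2 * (2 ^ n * suc k))        ≡⟨ cong (2 *_) (*-assoc 2 (2 ^ n) (suc k)) ⟨
    2 * (2 * 2 ^ n * suc k)          ∎
    where
    open ≤-Reasoning
    m = mass (suc k) n
    regroup : ∀ m → suc (suc (m + m)) ≡ 2 * suc m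
    regroup = solve-∀

  2^n*K≤mass : ∀ K n → 2 ^ n * K ≤ mass K n
  2^n*K≤mass K zero    = ≤-reflexive (+-identityʳ K)
  2^n*K≤mass K (suc n) = begin
    2 * 2 ^ n * K             ≡⟨ *-assoc 2 (2 ^ n) K ⟩
    2 * (2 ^ n * K)           ≤⟨ *-monoʳ-≤ 2 (2^n*K≤mass K n) ⟩
    mass K n + (mass K n + 0) ≤⟨ +-monoʳ-≤ (mass K n) (≤-trans (≤-reflexive (+-identityʳ _)) (n≤1+n _)) ⟩
    mass K n + suc (mass K n) ∎
    where open ≤-Reasoning

  n*2^n*K≤lowerBound : ∀ K n → n * (2 ^ n * K) ≤ lowerBound K n
  n*2^n*K≤lowerBound K zero    = z≤n
  n*2^n*K≤lowerBound K (suc n) = begin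
    suc n * (2 * 2 ^ n * K)                       ≡⟨ regroup n (2 ^ n) K ⟩
    2 * (n * (2 ^ n * K)) + 2 * 2 ^ n * K         ≤⟨ +-mono-≤
                                                       (*-monoʳ-≤ 2 (n*2^n*K≤lowerBound K n)) (2^n*K≤mass K (suc n)) ⟩
    2 * lowerBound K n + mass K (suc n)           ∎
    where
    open ≤-Reasoning
    regroup : ∀ n p K → suc n * (2 * p * K) ≡ 2 * (n * (p * K)) + 2 * p * K
    regroup = solve-∀

  -- Since `lowerBound` is at most twice the optimum, this makes the optimum, divided by the total
  -- weight, at least `n / 4`.
  n*mass≤2*lowerBound : ∀ k n → n * mass (suc k) n ≤ 2 * lowerBound (suc k) n
  n*mass≤2*lowerBound k n = begin
    n * mass (suc k) n             ≤⟨ *-monoʳ-≤ n (≤-trans (n≤1+n _) (mass-suc k n)) ⟩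
    n * (2 * (2 ^ n * suc k))      ≡⟨ regroup n (2 ^ n * suc k) ⟩
    2 * (n * (2 ^ n * suc k))      ≤⟨ *-monoʳ-≤ 2 (n*2^n*K≤lowerBound (suc k) n) ⟩
    2 * lowerBound (suc k) n       ∎
    where
    open ≤-Reasoning
    regroup : ∀ n p → n * (2 * p) ≡ 2 * (n * p)
    regroup = solve-∀

  -- Both recurrences add the same term, so their difference merely doubles from its initial value
  -- `K`, while the mass doubles and grows by 1.
  centroidCost≤lowerBound+mass : ∀ K n → centroidCost K n ≤ lowerBound K n + mass K n
  centroidCost≤lowerBound+mass K zero    = ≤-refl
  centroidCost≤lowerBound+mass K (suc n) = begin
    mass K (suc n) + 2 * centroidCost K n               ≤⟨ +-monoʳ-≤ (mass K (suc n))
                                                              (*-monoʳ-≤ 2 (centroidCost≤lowerBound+mass K n)) ⟩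
    mass K (suc n) + 2 * (lowerBound K n + mass K n)    ≤⟨ n≤1+n _ ⟩
    suc (mass K (suc n) + 2 * (lowerBound K n + mass K n)) ≡⟨ regroup (lowerBound K n) (mass K n) ⟩
    lowerBound K (suc n) + mass K (suc n)               ∎
    where
    open ≤-Reasoning
    regroup : ∀ l m → suc (m + suc m + 2 * (l + m)) ≡ 2 * l + (m + suc m) + (m + suc m)
    regroup = solve-∀

  -- The excess `v` of `2 * upperBound` over `centroidCost + mass` starts at 0 and passes to
  -- `2 * v + 4`. Hence `v + 4` doubles, from 4 at `n = 0`.
  2*upperBound+4 : ∀ K n → 2 * upperBound K n + 4 ≡ centroidCost K n + mass K n + 4 * 2 ^ n
  2*upperBound+4 K zero    = regroup K
    where
    regroup : ∀ K → 2 * K + 4 ≡ K + K + 4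
    regroup = solve-∀
  2*upperBound+4 K (suc n) = begin
    2 * (2 * u + m + 3) + 4                  ≡⟨ regroup₁ u m ⟩
    2 * (2 * u + 4) + 2 * m + 2              ≡⟨ cong (λ x → 2 * x + 2 * m + 2) (2*upperBound+4 K n) ⟩
    2 * (c + m + 4 * 2 ^ n) + 2 * m + 2      ≡⟨ regroup₂ c m (2 ^ n) ⟩
    (m + suc m) + 2 * c + (m + suc m) + 4 * (2 * 2 ^ n) ∎
    where
    open ≡-Reasoning
    u = upperBound K n
    m = mass K n
    c = centroidCost K n
    regroup₁ : ∀ u m → 2 * (2 * u + m + 3) + 4 ≡ 2 * (2 * u + 4) + 2 * m + 2
    regroup₁ = solve-∀
    regroup₂ : ∀ c m p → 2 * (c + m + 4 * p) + 2 * m + 2 ≡ (m + suc m) + 2 * c + (m + suc m) + 4 * (2 * p)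
    regroup₂ = solve-∀

  2*upperBound≤ : ∀ K n → 2 * upperBound K n ≤ centroidCost K n + mass K n + 4 * 2 ^ n
  2*upperBound≤ K n = ≤-trans (m≤m+n _ 4) (≤-reflexive (2*upperBound+4 K n))

  -- Fractions of natural numbers.

  toℚᵘ-/ : ∀ D .{{_ : NonZero D}} a → toℚᵘ (+ a ℚ./ D) ℚᵘ.≃ (+ a ℚᵘ./ D)
  toℚᵘ-/ (suc d) a = ℚ.toℚᵘ-fromℚᵘ (mkℚᵘ (+ a) d)

  /-mono-≤ : ∀ a D b E .{{_ : NonZero D}} .{{_ : NonZero E}} → a * E ≤ b * D → + a ℚ./ D ℚ.≤ + b ℚ./ E
  /-mono-≤ a D@(suc _) b E@(suc _) aE≤bD = ℚ.toℚᵘ-cancel-≤ (begin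
    toℚᵘ (+ a ℚ./ D)   ≃⟨ toℚᵘ-/ D a ⟩
    + a ℚᵘ./ D         ≤⟨ *≤* (subst₂ ℤ._≤_ (ℤ.pos-* a E) (ℤ.pos-* b D) (+≤+ aE≤bD)) ⟩
    + b ℚᵘ./ E         ≃⟨ toℚᵘ-/ E b ⟨
    toℚᵘ (+ b ℚ./ E)   ∎)
    where open ℚᵘ.≤-Reasoning

  /-cancel-≤ : ∀ {a b} D .{{_ : NonZero D}} → + a ℚ./ D ℚ.≤ + b ℚ./ D → a ≤ b
  /-cancel-≤ {a} {b} D@(suc _) le = *-cancelʳ-≤ a b D
    (ℤ.drop‿+≤+ (subst₂ ℤ._≤_ (sym (ℤ.pos-* a D)) (sym (ℤ.pos-* b D)) (ℚᵘ.drop-*≤* (begin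
      + a ℚᵘ./ D         ≃⟨ toℚᵘ-/ D a ⟨
      toℚᵘ (+ a ℚ./ D)   ≤⟨ ℚ.toℚᵘ-mono-≤ le ⟩
      toℚᵘ (+ b ℚ./ D)   ≃⟨ toℚᵘ-/ D b ⟩
      + b ℚᵘ./ D         ∎))))
    where open ℚᵘ.≤-Reasoning

  /-+ : ∀ D .{{_ : NonZero D}} a b → + (a + b) ℚ./ D ≡ + a ℚ./ D ℚ.+ + b ℚ./ D
  /-+ D@(suc _) a b = ℚ.toℚᵘ-injective (begin-equality
    toℚᵘ (+ (a + b) ℚ./ D)                      ≃⟨ toℚᵘ-/ D (a + b) ⟩
    + (a + b) ℚᵘ./ D                            ≃⟨ *≡* cross ⟩
    + a ℚᵘ./ D ℚᵘ.+ + b ℚᵘ./ D                  ≃⟨ ℚᵘ.+-cong (toℚᵘ-/ D a) (toℚᵘ-/ D b) ⟨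
    toℚᵘ (+ a ℚ./ D) ℚᵘ.+ toℚᵘ (+ b ℚ./ D)      ≃⟨ ℚ.toℚᵘ-homo-+ (+ a ℚ./ D) (+ b ℚ./ D) ⟨
    toℚᵘ (+ a ℚ./ D ℚ.+ + b ℚ./ D)              ∎)
    where
    open ℚᵘ.≤-Reasoning
    regroup : ∀ a b D → (a + b) * (D * D) ≡ (a * D + b * D) * D
    regroup = solve-∀
    cross : + (a + b) ℤ.* + (D * D) ≡ (+ a ℤ.* + D ℤ.+ + b ℤ.* + D) ℤ.* + D
    cross = trans (sym (ℤ.pos-* (a + b) (D * D))) (trans (cong +_ (regroup a b D))
      (trans (ℤ.pos-* (a * D + b * D) D)
        (cong (ℤ._* + D) (cong₂ ℤ._+_ (ℤ.pos-* a D) (ℤ.pos-* b D)))))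

  /-* : ∀ D .{{_ : NonZero D}} a c → + (a * c) ℚ./ D ≡ + a ℚ./ D ℚ.* (+ c ℚ./ 1)
  /-* D@(suc _) a c = ℚ.toℚᵘ-injective (begin-equality
    toℚᵘ (+ (a * c) ℚ./ D)                      ≃⟨ toℚᵘ-/ D (a * c) ⟩
    + (a * c) ℚᵘ./ D                            ≃⟨ *≡* cross ⟩
    (+ a ℚᵘ./ D) ℚᵘ.* (+ c ℚᵘ./ 1)              ≃⟨ ℚᵘ.*-cong (toℚᵘ-/ D a) (toℚᵘ-/ 1 c) ⟨
    toℚᵘ (+ a ℚ./ D) ℚᵘ.* toℚᵘ (+ c ℚ./ 1)      ≃⟨ ℚ.toℚᵘ-homo-* (+ a ℚ./ D) (+ c ℚ./ 1) ⟨
    toℚᵘ (+ a ℚ./ D ℚ.* (+ c ℚ./ 1))            ∎)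
    where
    open ℚᵘ.≤-Reasoning
    regroup : ∀ a c D → a * c * (D * 1) ≡ a * c * D
    regroup = solve-∀
    cross : + (a * c) ℤ.* + (D * 1) ≡ (+ a ℤ.* + c) ℤ.* + D
    cross = trans (sym (ℤ.pos-* (a * c) (D * 1))) (trans (cong +_ (regroup a c D))
      (trans (ℤ.pos-* (a * c) D) (cong (ℤ._* + D) (ℤ.pos-* a c))))

  n/n≡1 : ∀ D .{{_ : NonZero D}} → + D ℚ./ D ≡ 1ℚ
  n/n≡1 D = ℚ.≤-antisym (/-mono-≤ D D 1 1 (≤-reflexive (*-comm D 1))) (/-mono-≤ 1 1 D D (≤-reflexive (*-comm 1 D)))

  0/n≡0 : ∀ D .{{_ : NonZero D}} → + 0 ℚ./ D ≡ 0ℚ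
  0/n≡0 D = ℚ.≤-antisym (/-mono-≤ 0 D 0 1 z≤n) (/-mono-≤ 0 1 0 D z≤n)

  -- A positive fraction has numerator at least 1. Its denominator thus turns a tolerance into a
  -- natural number, from which `K` in (i) and the threshold in (ii) are chosen.
  1/↧≤ : ∀ q → 0ℚ ℚ.< q → + 1 ℚ./ ↧ₙ q ℚ.≤ q
  1/↧≤ q@(ℚ.mkℚ ℤ.+[1+ a ] d _) 0<q = ℚ.toℚᵘ-cancel-≤ (begin
    toℚᵘ (+ 1 ℚ./ suc d)     ≃⟨ toℚᵘ-/ (suc d) 1 ⟩
    + 1 ℚᵘ./ suc d           ≤⟨ *≤* (ℤ.*-monoʳ-≤-nonNeg (+ suc d) {+ 1} {ℤ.+[1+ a ]} (+≤+ (s≤s z≤n))) ⟩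
    toℚᵘ q                   ∎)
    where open ℚᵘ.≤-Reasoning
  1/↧≤ q@(ℚ.mkℚ (+ 0)      d _) 0<q with () ← ℚ.positive 0<q
  1/↧≤ q@(ℚ.mkℚ ℤ.-[1+ a ] d _) 0<q with () ← ℚ.positive 0<q

  ≤-natural : ∀ q → ∃[ k ] q ℚ.≤ + k ℚ./ 1
  ≤-natural q = ℤ.∣ ↥ q ∣ , ℚ.toℚᵘ-cancel-≤ (begin
    toℚᵘ q                       ≤⟨ bound q ⟩
    + ℤ.∣ ↥ q ∣ ℚᵘ./ 1           ≃⟨ toℚᵘ-/ 1 ℤ.∣ ↥ q ∣ ⟨
    toℚᵘ (+ ℤ.∣ ↥ q ∣ ℚ./ 1)     ∎)
    where
    open ℚᵘ.≤-Reasoning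
    bound : ∀ q → toℚᵘ q ℚᵘ.≤ + ℤ.∣ ↥ q ∣ ℚᵘ./ 1
    bound (ℚ.mkℚ (+ a)      d _) = *≤* (ℤ.*-monoˡ-≤-nonNeg (+ a) (+≤+ (s≤s z≤n)))
    bound (ℚ.mkℚ ℤ.-[1+ a ] d _) = *≤* (subst (ℤ._≤ + suc a ℤ.* + suc d) (sym (ℤ.*-identityʳ ℤ.-[1+ a ])) ℤ.-≤+)

-- Real inequalities between sequences of rationals.

open import Data.Integer.Base using (+_)
open import Defs
open Subgraphs using (wt; sum-filter; ⇔⇒≡)
open SearchTrees using (module Trees)
open Shapes using (X; leaf; centre; copy; apex; mass; mass-nonZero; toFin; fromFin; fromFin-toFin; toFin-fromFin;
  toFin-~; shape; _~_)
open ShapeCopies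
open Arithmetic

p≤p+q : ∀ {p q} → 0ℚ ℚ.≤ q → p ℚ.≤ p ℚ.+ q
p≤p+q {p} {q} 0≤q = subst (ℚ._≤ p ℚ.+ q) (ℚ.+-identityʳ p) (ℚ.+-monoʳ-≤ p 0≤q)

≤-pointwise : ∀ x y N → (∀ m → N ℕ.≤ m → seq x m ℚ.≤ seq y m) → x ≤ y
≤-pointwise x y N le ε 0<ε = N , λ m N≤m → ℚ.≤-trans (le m N≤m) (p≤p+q (ℚ.<⇒≤ 0<ε))

-- Otherwise half of the gap `p - q` would be a tolerance that `x ≤ y` violates.
≤-constant : ∀ x y {p q} → (∀ m → seq x m ≡ p) → (∀ m → seq y m ≡ q) → x ≤ y → p ℚ.≤ q
≤-constant x y {p} {q} x≡p y≡q x≤y = ℚ.≮⇒≥ λ q<p →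
  let ε = ½ ℚ.* (p ℚ.- q)
      0<p-q : 0ℚ ℚ.< p ℚ.- q
      0<p-q = subst (ℚ._< p ℚ.- q) (ℚ.+-inverseʳ q) (ℚ.+-monoˡ-< (ℚ.- q) q<p)
      0<ε : 0ℚ ℚ.< ε
      0<ε = subst (ℚ._< ε) (ℚ.*-zeroʳ ½) (ℚ.*-monoʳ-<-pos ½ 0<p-q)
      N , le = x≤y ε 0<ε
      p≤q+ε = subst₂ (λ p q → p ℚ.≤ q ℚ.+ ε) (x≡p N) (y≡q N) (le N ℕ.≤-refl)
  in ℚ.<-irrefl refl (begin-strict
    q ℚ.+ ε                ≡⟨ ℚ.+-identityʳ (q ℚ.+ ε) ⟨
    q ℚ.+ ε ℚ.+ 0ℚ         <⟨ ℚ.+-monoʳ-< (q ℚ.+ ε) 0<ε ⟩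
    q ℚ.+ ε ℚ.+ ε          ≡⟨ ℚ.+-assoc q ε ε ⟩
    q ℚ.+ (ε ℚ.+ ε)        ≡⟨ cong (q ℚ.+_) (trans (sym (ℚ.*-distribʳ-+ (p ℚ.- q) ½ ½))
                                                  (ℚ.*-identityˡ (p ℚ.- q))) ⟩
    q ℚ.+ (p ℚ.- q)        ≡⟨ regroup p q ⟩
    p                      ≤⟨ p≤q+ε ⟩
    q ℚ.+ ε                ∎)
  where
  open ℚ.≤-Reasoning
  regroup : ∀ p q → q ℚ.+ (p ℚ.- q) ≡ p
  regroup = solve 2 (λ p q → q :+ (p :- q) := p) refl
    where open +-*-Solver

eventually-≤ℕ : ∀ x → ∃[ k ] ∃[ N ] ∀ m → N ℕ.≤ m → seq x m ℚ.≤ + k ℚ./ 1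
eventually-≤ℕ x =
  let N , h = cauchy x 1ℚ (ℚ.positive⁻¹ 1ℚ)
      k , le = ≤-natural (seq x N ℚ.+ 1ℚ)
  in k , N , λ m N≤m → ℚ.≤-trans (begin
    seq x m                                       ≡⟨ regroup (seq x m) (seq x N) ⟩
    seq x N ℚ.+ (seq x m ℚ.- seq x N)             ≤⟨ ℚ.+-monoʳ-≤ (seq x N) (≤∣∣ (seq x m ℚ.- seq x N)) ⟩
    seq x N ℚ.+ ℚ.∣ seq x m ℚ.- seq x N ∣         ≤⟨ ℚ.+-monoʳ-≤ (seq x N) (h m N N≤m ℕ.≤-refl) ⟩
    seq x N ℚ.+ 1ℚ                                ∎) le
  where
  open ℚ.≤-Reasoning
  regroup : ∀ a c → a ≡ c ℚ.+ (a ℚ.- c)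
  regroup = solve 2 (λ a c → a := c :+ (a :- c)) refl
    where open +-*-Solver
  ≤∣∣ : ∀ p → p ℚ.≤ ℚ.∣ p ∣
  ≤∣∣ p with ℚ.≤-total 0ℚ p
  ... | inj₁ 0≤p = ℚ.≤-reflexive (sym (ℚ.0≤p⇒∣p∣≡p 0≤p))
  ... | inj₂ p≤0 = ℚ.≤-trans p≤0 (ℚ.0≤∣p∣ p)

toFin-copy : ∀ K n (weight : Fin (mass 1 n) → ℝ) (nonNeg : ∀ v → 0ℝ ≤ weight v) →
  Copies.Copy (record { tree = shape n ; weight = weight ; nonNeg = nonNeg }) (weightX K ∘ fromFin n) K toFin
toFin-copy K n weight nonNeg = record
  { injective = λ {a} {b} eq → trans (sym (fromFin-toFin a)) (trans (cong (fromFin n) eq) (fromFin-toFin b))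
  ; adj⁺      = toFin-~
  ; adj⁻      = λ {a} {b} → subst₂ _~_ (fromFin-toFin a) (fromFin-toFin b)
  ; weight    = λ a → cong (weightX K) (fromFin-toFin a)
  }

-- What the two kinds of instances share: the optimum and the two bounds relating it to centroid
-- trees.

module Instances (I : Instance) (w : Fin (Instance.order I) → ℕ) (k n : ℕ)
  {e : X n → Fin (Instance.order I)} (e-copy : Copies.Copy I w (suc k) e) (e-onto : ∀ v → ∃[ a ] e a ≡ v)
  .{{_ : NonZero (mass (suc k) n)}}
  (weight≡ : ∀ v m → seq (Instance.weight I v) m ≡ + w v ℚ./ mass (suc k) n) where

  open Instance I using (tree)
  open Trees I w
  open Copies I w (suc k)

  K D : ℕ
  K = suc k
  D = mass K n

  abstract
    -- Division by the total weight preserves and reflects the order. Every comparison of real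
    -- weights or costs is thereby one of natural numbers.
    φ : ℕ → ℚ
    φ a = + a ℚ./ D

    φ-def : ∀ a → + a ℚ./ D ≡ φ a
    φ-def a = refl

    φ-mono : ∀ {a b} → a ℕ.≤ b → φ a ℚ.≤ φ b
    φ-mono {a} {b} a≤b = /-mono-≤ a D b D (ℕ.*-monoˡ-≤ D a≤b)

    φ-cancel : ∀ a b → φ a ℚ.≤ φ b → a ℕ.≤ b
    φ-cancel a b = /-cancel-≤ D

    φ-+ : ∀ a b → φ (a ℕ.+ b) ≡ φ a ℚ.+ φ b
    φ-+ = /-+ D

    φ-* : ∀ a c → φ (a ℕ.* c) ≡ φ a ℚ.* (+ c ℚ./ 1)
    φ-* = /-* D

    φ-0 : φ 0 ≡ 0ℚ
    φ-0 = 0/n≡0 D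

    φ-D : φ D ≡ 1ℚ
    φ-D = n/n≡1 D

  image≡⊤ : image e ≡ ⊤
  image≡⊤ = ⇔⇒≡ λ v → mk⇔ (λ _ → ∈⊤) (λ _ →
    let a , ea≡v = e-onto v in subst (Subset._∈ image e) ea≡v (∈-image⁺ e a))

  wt-⊤ : wt w ⊤ ≡ D
  wt-⊤ = trans (cong (wt w) (sym image≡⊤)) (wt-image e-copy)

  seq-weightOf : ∀ S m → seq (weightOf I S) m ≡ φ (wt w S)
  seq-weightOf S m = trans (go (List.filter (_∈? S) (List.allFin (Instance.order I))))
    (cong φ (sum-filter w (_∈? S) id S λ i → mk⇔ id id))
    where
    go : ∀ vs → seq (sum (List.map (Instance.weight I) vs)) m ≡ φ (ℕ.sum (List.map w vs))
    go []       = sym φ-0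
    go (v ∷ vs) = trans (cong₂ ℚ._+_ (trans (weight≡ v m) (φ-def (w v))) (go vs)) (sym (φ-+ (w v) (ℕ.sum (List.map w vs))))

  seq-cost : ∀ T m → seq (cost I T) m ≡ φ (cst T)
  seq-cost T m = trans (go (depths T)) (cong φ (depthCost-depths T))
    where
    go : ∀ ds → seq (sum (List.map (λ (v , d) → Instance.weight I v * fromℕ d) ds)) m ≡ φ (depthCost ds)
    go []             = sym φ-0
    go ((v , d) ∷ ds) = trans
      (cong₂ ℚ._+_ (trans (cong (ℚ._* (+ d ℚ./ 1)) (trans (weight≡ v m) (φ-def (w v)))) (sym (φ-* (w v) d))) (go ds))
      (sym (φ-+ (w v ℕ.* d) (depthCost ds)))

  totalWeight≃1 : totalWeight I ≃ 1ℝ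
  totalWeight≃1 = ≤-pointwise (totalWeight I) 1ℝ 0 (λ m _ → ℚ.≤-reflexive (eq m))
                , ≤-pointwise 1ℝ (totalWeight I) 0 (λ m _ → ℚ.≤-reflexive (sym (eq m)))
    where
    eq : ∀ m → seq (totalWeight I) m ≡ 1ℚ
    eq m = trans (seq-weightOf ⊤ m) (trans (cong φ wt-⊤) φ-D)

  halved : ∀ {S r} → IsCentroid I S r → ∀ H → Instance.IsComponent I (S Subset.- r) H → 2 ℕ.* wt w H ℕ.≤ wt w S
  halved {S} (_ , half) H c = φ-cancel (2 ℕ.* wt w H) (wt w S) (begin
    φ (2 ℕ.* wt w H)                    ≡⟨ cong φ (ℕ.*-comm 2 (wt w H)) ⟩
    φ (wt w H ℕ.* 2)                    ≡⟨ φ-* (wt w H) 2 ⟩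
    φ (wt w H) ℚ.* (+ 2 ℚ./ 1)          ≤⟨ ℚ.*-monoʳ-≤-nonNeg (+ 2 ℚ./ 1)
                                            (≤-constant (weightOf I H) (weightOf I S * ½ℝ) (seq-weightOf H)
                                              (λ m → cong (ℚ._* ½) (seq-weightOf S m)) (half H c)) ⟩
    φ (wt w S) ℚ.* ½ ℚ.* (+ 2 ℚ./ 1)    ≡⟨ ℚ.*-assoc (φ (wt w S)) ½ (+ 2 ℚ./ 1) ⟩
    φ (wt w S) ℚ.* 1ℚ                   ≡⟨ ℚ.*-identityʳ (φ (wt w S)) ⟩
    φ (wt w S)                          ∎)
    where open ℚ.≤-Reasoning

  abstract
    optimum : ∃ (Optimal {⊤})
    optimum = optimal (suc Subset.∣ ⊤ {Instance.order I} ∣) ℕ.≤-refl (∈⊤ {x = e apex})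

  opt : ℕ
  opt = cst (proj₁ optimum)

  OPT : ℝ
  OPT = fromℚ (φ opt)

  OPT-isOPT : IsOPT I OPT
  OPT-isOPT = (T₀ , ≤-pointwise (cost I T₀) OPT 0 (λ m _ → ℚ.≤-reflexive (seq-cost T₀ m))
                  , ≤-pointwise OPT (cost I T₀) 0 (λ m _ → ℚ.≤-reflexive (sym (seq-cost T₀ m))))
            , λ T → ≤-pointwise OPT (cost I T) 0 λ m _ →
                ℚ.≤-trans (φ-mono (proj₂ optimum T)) (ℚ.≤-reflexive (sym (seq-cost T m)))
    where
    T₀ : SearchTree tree
    T₀ = proj₁ optimum

  cst-centroidTree : ∀ C → IsCentroidTree I C → cst C ≡ centroidCost K n
  cst-centroidTree = subst (λ S → ∀ (T : SearchTreeOn tree S) → AllCentroids I T → cst T ≡ centroidCost K n)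
    image≡⊤ (cst-centroid halved e-copy)

  opt≤upperBound : opt ℕ.≤ upperBound K n
  opt≤upperBound
    with T , _ , eq ← subst (λ S → Σ[ T ∈ SearchTreeOn tree S ] root T ≡ e apex × cst T ≡ upperBound K n)
                         image≡⊤ (apexTree e-copy)
    = ℕ.≤-trans (proj₂ optimum T) (ℕ.≤-reflexive eq)

  lowerBound≤2*opt : lowerBound K n ℕ.≤ 2 ℕ.* opt
  lowerBound≤2*opt = subst (λ S → ∀ (T : SearchTreeOn tree S) → lowerBound K n ℕ.≤ 2 ℕ.* cst T)
    image≡⊤ (lowerBound≤cst e-copy) (proj₁ optimum)

  n*D≤4*opt : n ℕ.* D ℕ.≤ 4 ℕ.* opt
  n*D≤4*opt = begin
    n ℕ.* D                    ≤⟨ n*mass≤2*lowerBound k n ⟩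
    2 ℕ.* lowerBound K n       ≤⟨ ℕ.*-monoʳ-≤ 2 lowerBound≤2*opt ⟩
    2 ℕ.* (2 ℕ.* opt)          ≡⟨ ℕ.*-assoc 2 2 opt ⟨
    4 ℕ.* opt                  ∎
    where open ℕ.≤-Reasoning

  natural≤OPT : ∀ M → 4 ℕ.* M ℕ.≤ n → + M ℚ./ 1 ℚ.≤ φ opt
  natural≤OPT M 4M≤n = subst (+ M ℚ./ 1 ℚ.≤_) (φ-def opt) $ /-mono-≤ M 1 opt D (ℕ.*-cancelˡ-≤ 4 (begin
    4 ℕ.* (M ℕ.* D)        ≡⟨ ℕ.*-assoc 4 M D ⟨
    4 ℕ.* M ℕ.* D          ≤⟨ ℕ.*-monoˡ-≤ D 4M≤n ⟩
    n ℕ.* D                ≤⟨ n*D≤4*opt ⟩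
    4 ℕ.* opt              ≡⟨ cong (4 ℕ.*_) (ℕ.*-identityʳ opt) ⟨
    4 ℕ.* (opt ℕ.* 1)      ∎))
    where open ℕ.≤-Reasoning

  1≤φopt : 1ℚ ℚ.≤ φ opt
  1≤φopt = subst (ℚ._≤ φ opt) φ-D (φ-mono (ℕ.≤-trans (ℕ.≤-reflexive (sym wt-⊤)) (wt≤cst (proj₁ optimum))))
    where
    wt≤cst : ∀ {S} (T : SearchTreeOn tree S) → wt w S ℕ.≤ cst T
    wt≤cst (node _ _ _ _ _ _) = ℕ.m≤m+n _ _

  0<OPT : 0ℝ < OPT
  0<OPT = 1ℚ , ℚ.positive⁻¹ 1ℚ , 0 , λ _ _ → 1≤φopt

  2*opt≤ : ∀ C → IsCentroidTree I C → 2 ℕ.* opt ℕ.≤ cst C ℕ.+ D ℕ.+ 4 ℕ.* 2 ℕ.^ n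
  2*opt≤ C cen = subst (λ c → 2 ℕ.* opt ℕ.≤ c ℕ.+ D ℕ.+ 4 ℕ.* 2 ℕ.^ n) (sym (cst-centroidTree C cen))
    (ℕ.≤-trans (ℕ.*-monoʳ-≤ 2 opt≤upperBound) (2*upperBound≤ K n))

  cst-centroidTree≤ : ∀ C → IsCentroidTree I C → cst C ℕ.≤ 2 ℕ.* opt ℕ.+ D
  cst-centroidTree≤ C cen = subst (ℕ._≤ 2 ℕ.* opt ℕ.+ D) (sym (cst-centroidTree C cen))
    (ℕ.≤-trans (centroidCost≤lowerBound+mass K n) (ℕ.+-monoˡ-≤ D lowerBound≤2*opt))

  φ-2* : ∀ a → φ (2 ℕ.* a) ≡ (+ 2 ℚ./ 1) ℚ.* φ a
  φ-2* a = trans (cong φ (ℕ.*-comm 2 a)) (trans (φ-* a 2) (ℚ.*-comm (φ a) (+ 2 ℚ./ 1)))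

  -- After the division the summand `D` is the 1 of the claim, and `4 * 2 ^ n` becomes the
  -- correction that a large `K` makes small.
  φ-centroidTree-lower : ∀ C → IsCentroidTree I C →
    (+ 2 ℚ./ 1) ℚ.* φ opt ℚ.≤ φ (cst C) ℚ.+ 1ℚ ℚ.+ φ (4 ℕ.* 2 ℕ.^ n)
  φ-centroidTree-lower C cen = begin
    (+ 2 ℚ./ 1) ℚ.* φ opt                          ≡⟨ φ-2* opt ⟨
    φ (2 ℕ.* opt)                                  ≤⟨ φ-mono (2*opt≤ C cen) ⟩
    φ (cst C ℕ.+ D ℕ.+ 4 ℕ.* 2 ℕ.^ n)              ≡⟨ φ-+ (cst C ℕ.+ D) _ ⟩
    φ (cst C ℕ.+ D) ℚ.+ φ (4 ℕ.* 2 ℕ.^ n)          ≡⟨ cong (ℚ._+ φ (4 ℕ.* 2 ℕ.^ n))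
                                                          (trans (φ-+ (cst C) D) (cong (φ (cst C) ℚ.+_) φ-D)) ⟩
    φ (cst C) ℚ.+ 1ℚ ℚ.+ φ (4 ℕ.* 2 ℕ.^ n)         ∎
    where open ℚ.≤-Reasoning

  φ-centroidTree-upper : ∀ C → IsCentroidTree I C → φ (cst C) ℚ.≤ (+ 2 ℚ./ 1) ℚ.* φ opt ℚ.+ 1ℚ
  φ-centroidTree-upper C cen = begin
    φ (cst C)                             ≤⟨ φ-mono (cst-centroidTree≤ C cen) ⟩
    φ (2 ℕ.* opt ℕ.+ D)                   ≡⟨ φ-+ (2 ℕ.* opt) D ⟩
    φ (2 ℕ.* opt) ℚ.+ φ D                 ≡⟨ cong₂ ℚ._+_ (φ-2* opt) φ-D ⟩
    (+ 2 ℚ./ 1) ℚ.* φ opt ℚ.+ 1ℚ          ∎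
    where open ℚ.≤-Reasoning

⟶∞-of-linear-growth : ∀ (o : ℕ → ℚ) → (∀ n M → 4 ℕ.* M ℕ.≤ n → + M ℚ./ 1 ℚ.≤ o n) → (fromℚ ∘ o) ⟶∞
⟶∞-of-linear-growth o growth b =
  let M , N , b≤M = eventually-≤ℕ b
  in 4 ℕ.* M , λ n 4M≤n → ≤-pointwise b (fromℚ (o n)) N λ m N≤m → ℚ.≤-trans (b≤M m N≤m) (growth n M 4M≤n)

-- The weighted and the uniform instances.

module Weighted (k n : ℕ) where
  instance
    D-nonZero : NonZero (mass (suc k) n)
    D-nonZero = mass-nonZero k n

  weight : ∀ v → ℝ
  weight v = fromℚ (+ weightX (suc k) (fromFin n v) ℚ./ mass (suc k) n)

  weight-nonNeg : ∀ v → 0ℝ ≤ weight v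
  weight-nonNeg v = ≤-pointwise 0ℝ (weight v) 0 λ _ _ →
    /-mono-≤ 0 1 (weightX (suc k) (fromFin n v)) (mass (suc k) n) ℕ.z≤n

  I : Instance
  I = record { tree = shape n ; weight = weight ; nonNeg = weight-nonNeg }

  w : Fin (mass 1 n) → ℕ
  w = weightX (suc k) ∘ fromFin n

  open Instances I w k n (toFin-copy (suc k) n weight weight-nonNeg)
    (λ v → fromFin n v , toFin-fromFin n v) (λ _ _ → refl) public

module Uniform (n : ℕ) where
  instance
    order-nonZero : NonZero (mass 1 n)
    order-nonZero = mass-nonZero 0 n

  weightX≡1 : ∀ {n} (a : X n) → weightX 1 a ≡ 1
  weightX≡1 leaf       = refl
  weightX≡1 centre     = refl
  weightX≡1 (copy _ a) = weightX≡1 a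

  w : Fin (mass 1 n) → ℕ
  w = weightX 1 ∘ fromFin n

  open Instances (uniform (shape n)) w 0 n
    (toFin-copy 1 n (Instance.weight (uniform (shape n))) (Instance.nonNeg (uniform (shape n))))
    (λ v → fromFin n v , toFin-fromFin n v)
    -- The tree has `mass 1 n` vertices, so the uniform probability is the weight 1 over the common
    -- denominator.
    (λ v _ → cong (λ a → + a ℚ./ mass 1 n) (sym (weightX≡1 (fromFin n v)))) public

-- The choice of `K` for (i), and the limit of the ratio for (ii).

2ℚ : ℚ
2ℚ = + 2 ℚ./ 1

-- The choice of K makes the error at most 1 / ↧ₙ e.
small-correction : ∀ e n → 0ℚ ℚ.< e → let open Weighted (4 ℕ.* ↧ₙ e) n in φ (4 ℕ.* 2 ℕ.^ n) ℚ.≤ e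
small-correction e n 0<e = ℚ.≤-trans
  (subst (ℚ._≤ + 1 ℚ./ ↧ₙ e) (φ-def (4 ℕ.* 2 ℕ.^ n)) (/-mono-≤ (4 ℕ.* 2 ℕ.^ n) D 1 (↧ₙ e) (begin
    -- Here `K` is `suc (4 * ↧ₙ e)`: the factor 4 cancels that of the correction, and the successor
    -- makes `K` visibly positive.
    4 ℕ.* 2 ℕ.^ n ℕ.* ↧ₙ e           ≡⟨ regroup (2 ℕ.^ n) (↧ₙ e) ⟩
    2 ℕ.^ n ℕ.* (4 ℕ.* ↧ₙ e)         ≤⟨ ℕ.*-monoʳ-≤ (2 ℕ.^ n) (ℕ.n≤1+n _) ⟩
    2 ℕ.^ n ℕ.* K                    ≤⟨ 2^n*K≤mass K n ⟩
    D                                ≡⟨ ℕ.*-identityˡ D ⟨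
    1 ℕ.* D                          ∎)))
  (1/↧≤ e 0<e)
  where
  open Weighted (4 ℕ.* ↧ₙ e) n
  open ℕ.≤-Reasoning
  regroup : ∀ p d → 4 ℕ.* p ℕ.* d ≡ p ℕ.* (4 ℕ.* d)
  regroup = solve-∀

0+≤⇒≤ : ∀ {p q} → 0ℚ ℚ.+ p ℚ.≤ q → p ℚ.≤ q
0+≤⇒≤ {p} {q} = subst (ℚ._≤ q) (ℚ.+-identityˡ p)

difference-bound : ∀ {c o s x} → 2ℚ ℚ.* o ℚ.≤ c ℚ.+ 1ℚ ℚ.+ s → s ℚ.≤ x → 2ℚ ℚ.* o ℚ.- 1ℚ ℚ.- x ℚ.≤ c
difference-bound {c} {o} {s} {x} 2o≤ s≤x = begin
  2ℚ ℚ.* o ℚ.- 1ℚ ℚ.- x            ≤⟨ ℚ.+-monoˡ-≤ (ℚ.- x) (ℚ.+-monoˡ-≤ (ℚ.- 1ℚ)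
                                         (ℚ.≤-trans 2o≤ (ℚ.+-monoʳ-≤ (c ℚ.+ 1ℚ) s≤x))) ⟩
  c ℚ.+ 1ℚ ℚ.+ x ℚ.- 1ℚ ℚ.- x      ≡⟨ regroup c 1ℚ x ⟩
  c                                ∎
  where
  open ℚ.≤-Reasoning
  regroup : ∀ c o x → c ℚ.+ o ℚ.+ x ℚ.- o ℚ.- x ≡ c
  regroup = solve 3 (λ c o x → c :+ o :+ x :- o :- x := c) refl
    where open +-*-Solver

-- The rational `e` comes from the proof of `0ℝ < ε` and bounds `ε` from below. `K` depends on it
-- alone, so that one choice serves all `n`.
weighted-bound : ∀ ε e N → 0ℚ ℚ.< e → (∀ m → N ℕ.≤ m → 0ℚ ℚ.+ e ℚ.≤ seq ε m) → ∀ n C →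
  IsCentroidTree (Weighted.I (4 ℕ.* ↧ₙ e) n) C →
  2ℝ * Weighted.OPT (4 ℕ.* ↧ₙ e) n - 1ℝ - ε ≤ cost (Weighted.I (4 ℕ.* ↧ₙ e) n) C
weighted-bound ε e N 0<e e≤ε n C cen = ≤-pointwise
  (2ℝ * Weighted.OPT (4 ℕ.* ↧ₙ e) n - 1ℝ - ε) (cost (Weighted.I (4 ℕ.* ↧ₙ e) n) C) N λ m N≤m →
  subst (2ℚ ℚ.* φ opt ℚ.- 1ℚ ℚ.- seq ε m ℚ.≤_) (sym (seq-cost C m))
    (difference-bound {φ (Trees.cst I w C)} {φ opt} {φ (4 ℕ.* 2 ℕ.^ n)} {seq ε m} (φ-centroidTree-lower C cen)
      (ℚ.≤-trans (small-correction e n 0<e) (0+≤⇒≤ (e≤ε m N≤m))))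
  where
  open Weighted (4 ℕ.* ↧ₙ e) n

-- With `d` the denominator of `e`, multiply `e ≥ 1 / d` and `o ≥ 5 * d`. The 5 is the additive
-- error to be absorbed: 1 for the total weight, and 4 for the correction at `K = 1`.
5≤*OPT : ∀ e o → 0ℚ ℚ.< e → + (5 ℕ.* ↧ₙ e) ℚ./ 1 ℚ.≤ o → + 5 ℚ./ 1 ℚ.≤ e ℚ.* o
5≤*OPT e o 0<e M≤o = begin
  + 5 ℚ./ 1                                         ≤⟨ /-mono-≤ 5 1 (1 ℕ.* (5 ℕ.* ↧ₙ e)) (↧ₙ e)
                                                         (ℕ.≤-reflexive (eq (↧ₙ e))) ⟩
  + (1 ℕ.* (5 ℕ.* ↧ₙ e)) ℚ./ ↧ₙ e                   ≡⟨ /-* (↧ₙ e) 1 (5 ℕ.* ↧ₙ e) ⟩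
  + 1 ℚ./ ↧ₙ e ℚ.* (+ (5 ℕ.* ↧ₙ e) ℚ./ 1)           ≤⟨ ℚ.*-monoʳ-≤-nonNeg (+ (5 ℕ.* ↧ₙ e) ℚ./ 1)
                                                         {{ℚ.nonNegative 0≤M}} (1/↧≤ e 0<e) ⟩
  e ℚ.* (+ (5 ℕ.* ↧ₙ e) ℚ./ 1)                      ≤⟨ ℚ.*-monoˡ-≤-nonNeg e {{ℚ.nonNegative (ℚ.<⇒≤ 0<e)}} M≤o ⟩
  e ℚ.* o                                           ∎
  where
  open ℚ.≤-Reasoning
  eq : ∀ d → 5 ℕ.* d ≡ 1 ℕ.* (5 ℕ.* d) ℕ.* 1
  eq = solve-∀
  0≤M : 0ℚ ℚ.≤ + (5 ℕ.* ↧ₙ e) ℚ./ 1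
  0≤M = /-mono-≤ 0 1 (5 ℕ.* ↧ₙ e) 1 ℕ.z≤n

-- The cost differs from `2 * o` by at most 5, which is at most `e * o`; dividing by `o` leaves an
-- error of at most `e`.
ratio-bounds : ∀ {c o e} → 1ℚ ℚ.≤ o → + 5 ℚ./ 1 ℚ.≤ e ℚ.* o →
  2ℚ ℚ.* o ℚ.≤ c ℚ.+ (+ 5 ℚ./ 1) → c ℚ.≤ 2ℚ ℚ.* o ℚ.+ 1ℚ →
  2ℚ ℚ.- e ℚ.≤ c ℚ.* recip o × c ℚ.* recip o ℚ.≤ 2ℚ ℚ.+ e
ratio-bounds {c} {o} {e} 1≤o 5≤eo 2o≤c+5 c≤2o+1 =
    subst (ℚ._≤ c ℚ.* r) (cancel (2ℚ ℚ.- e)) (ℚ.*-monoʳ-≤-nonNeg r lower)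
  , subst (c ℚ.* r ℚ.≤_) (cancel (2ℚ ℚ.+ e)) (ℚ.*-monoʳ-≤-nonNeg r upper)
  where
  open ℚ.≤-Reasoning
  r = recip o
  0<o : 0ℚ ℚ.< o
  0<o = ℚ.<-≤-trans (ℚ.positive⁻¹ 1ℚ) 1≤o
  instance
    r-nonNeg : ℚ.NonNegative r
    r-nonNeg = ℚ.nonNegative (ℚ.<⇒≤ (recip-pos 0<o))
  cancel : ∀ p → p ℚ.* o ℚ.* r ≡ p
  cancel p = trans (ℚ.*-assoc p o r)
    (trans (cong (p ℚ.*_) (trans (ℚ.*-comm o r) (recip-inverseˡ 0<o))) (ℚ.*-identityʳ p))
  5ℚ = + 5 ℚ./ 1
  lower : (2ℚ ℚ.- e) ℚ.* o ℚ.≤ c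
  lower = begin
    (2ℚ ℚ.- e) ℚ.* o              ≡⟨ expand 2ℚ e o ⟩
    2ℚ ℚ.* o ℚ.- e ℚ.* o          ≤⟨ ℚ.+-mono-≤ 2o≤c+5 (ℚ.neg-antimono-≤ 5≤eo) ⟩
    c ℚ.+ 5ℚ ℚ.- 5ℚ               ≡⟨ regroup c 5ℚ ⟩
    c                             ∎
    where
    open +-*-Solver
    expand : ∀ t e o → (t ℚ.- e) ℚ.* o ≡ t ℚ.* o ℚ.- e ℚ.* o
    expand = solve 3 (λ t e o → (t :- e) :* o := t :* o :- e :* o) refl
    regroup : ∀ c f → c ℚ.+ f ℚ.- f ≡ c
    regroup = solve 2 (λ c f → c :+ f :- f := c) refl
  upper : c ℚ.≤ (2ℚ ℚ.+ e) ℚ.* o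
  upper = begin
    c                             ≤⟨ c≤2o+1 ⟩
    2ℚ ℚ.* o ℚ.+ 1ℚ               ≤⟨ ℚ.+-monoʳ-≤ (2ℚ ℚ.* o) (ℚ.≤-trans (/-mono-≤ 1 1 5 1 (ℕ.s≤s ℕ.z≤n)) 5≤eo) ⟩
    2ℚ ℚ.* o ℚ.+ e ℚ.* o          ≡⟨ ℚ.*-distribʳ-+ o 2ℚ e ⟨
    (2ℚ ℚ.+ e) ℚ.* o              ∎

-- At `K = 1` the total weight is still at least `2 ^ n`, so the correction is at most 4. It need
-- not tend to 0, since the ratio divides it by a growing optimum.
uniform-lower : ∀ n → let open Uniform n in ∀ C → IsCentroidTree (uniform (shape n)) C →
  2ℚ ℚ.* φ opt ℚ.≤ φ (Trees.cst (uniform (shape n)) w C) ℚ.+ (+ 5 ℚ./ 1)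
uniform-lower n C cen = begin
  2ℚ ℚ.* φ opt                                        ≤⟨ φ-centroidTree-lower C cen ⟩
  φ (cst C) ℚ.+ 1ℚ ℚ.+ φ (4 ℕ.* 2 ℕ.^ n)              ≤⟨ ℚ.+-monoʳ-≤ (φ (cst C) ℚ.+ 1ℚ) 4*2^n≤4 ⟩
  φ (cst C) ℚ.+ 1ℚ ℚ.+ (+ 4 ℚ./ 1)                    ≡⟨ ℚ.+-assoc (φ (cst C)) 1ℚ (+ 4 ℚ./ 1) ⟩
  φ (cst C) ℚ.+ (+ 5 ℚ./ 1)                           ∎
  where
  open Uniform n
  open Trees (uniform (shape n)) w using (cst)
  open ℚ.≤-Reasoning
  4*2^n≤4 : φ (4 ℕ.* 2 ℕ.^ n) ℚ.≤ + 4 ℚ./ 1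
  4*2^n≤4 = subst (ℚ._≤ + 4 ℚ./ 1) (φ-def (4 ℕ.* 2 ℕ.^ n)) (/-mono-≤ (4 ℕ.* 2 ℕ.^ n) D 4 1
    (ℕ.≤-trans (ℕ.≤-reflexive (ℕ.*-assoc 4 (2 ℕ.^ n) 1)) (ℕ.*-monoʳ-≤ 4 (2^n*K≤mass 1 n))))

seq-÷ : ∀ x y (0<y : 0ℝ < y) m → seq (x ÷ y [ 0<y ]) m ≡ seq x m ℚ.* recip (seq y m)
seq-÷ x y (_ , _ , _ , _) m = refl

uniform-ratio-seq : ∀ n C m →
  seq (cost (uniform (shape n)) C ÷ Uniform.OPT n [ Uniform.0<OPT n ]) m
    ≡ Uniform.φ n (Trees.cst (uniform (shape n)) (Uniform.w n) C) ℚ.* recip (Uniform.φ n (Uniform.opt n))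
uniform-ratio-seq n C m = trans
  (seq-÷ (cost (uniform (shape n)) C) (Uniform.OPT n) (Uniform.0<OPT n) m)
  (cong (ℚ._* recip (Uniform.φ n (Uniform.opt n))) (Uniform.seq-cost n C m))

uniform-ratio-bounds : ∀ e → 0ℚ ℚ.< e → ∀ n → 4 ℕ.* (5 ℕ.* ↧ₙ e) ℕ.≤ n →
  ∀ C → IsCentroidTree (uniform (shape n)) C → ∀ m →
  let q = seq (cost (uniform (shape n)) C ÷ Uniform.OPT n [ Uniform.0<OPT n ]) m
  in 2ℚ ℚ.- e ℚ.≤ q × q ℚ.≤ 2ℚ ℚ.+ e
uniform-ratio-bounds e 0<e n N≤n C cen m = subst (λ q → 2ℚ ℚ.- e ℚ.≤ q × q ℚ.≤ 2ℚ ℚ.+ e)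
  (sym (uniform-ratio-seq n C m))
  (ratio-bounds {φ (Trees.cst (uniform (shape n)) w C)} {φ opt} {e} 1≤φopt
    (5≤*OPT e (φ opt) 0<e (natural≤OPT (5 ℕ.* ↧ₙ e) N≤n))
    (uniform-lower n C cen) (φ-centroidTree-upper C cen))
  where open Uniform n

uniform-limit : ∀ (C : ∀ n → SearchTree (shape n)) → (∀ n → IsCentroidTree (uniform (shape n)) (C n)) →
  (λ n → cost (uniform (shape n)) (C n) ÷ Uniform.OPT n [ Uniform.0<OPT n ]) ⟶ 2ℝ
-- By `natural≤OPT` the optimum is at least `M` once `n` is at least `4 * M`; here `M` is 5 times
-- the denominator of `e`.
uniform-limit C cen ε (e , 0<e , N , e≤ε) = 4 ℕ.* (5 ℕ.* ↧ₙ e) , λ n N≤n →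
    ≤-pointwise (2ℝ - ε) (cost (uniform (shape n)) (C n) ÷ Uniform.OPT n [ Uniform.0<OPT n ]) N
      (λ m N≤m → ℚ.≤-trans
        (ℚ.+-monoʳ-≤ 2ℚ (ℚ.neg-antimono-≤ (0+≤⇒≤ {e} {seq ε m} (e≤ε m N≤m))))
        (proj₁ (uniform-ratio-bounds e 0<e n N≤n (C n) (cen n) m)))
  , ≤-pointwise (cost (uniform (shape n)) (C n) ÷ Uniform.OPT n [ Uniform.0<OPT n ]) (2ℝ + ε) N
      (λ m N≤m → ℚ.≤-trans
        (proj₂ (uniform-ratio-bounds e 0<e n N≤n (C n) (cen n) m))
        (ℚ.+-monoʳ-≤ 2ℚ (0+≤⇒≤ {e} {seq ε m} (e≤ε m N≤m))))

theorem2 : (∀ (ε : ℝ) → 0ℝ < ε →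
    Σ[ I ∈ (ℕ → Instance) ]
    Σ[ OPT ∈ (ℕ → ℝ) ]
    (∀ n → IsOPT (I n) (OPT n)) ×
    (∀ n → totalWeight (I n) ≃ 1ℝ) ×
    (OPT ⟶∞) ×
    (∀ n (C : SearchTree (Instance.tree (I n))) → IsCentroidTree (I n) C →
    2ℝ * OPT n - 1ℝ - ε ≤ cost (I n) C))
    ×
    (Σ[ 𝒯 ∈ (ℕ → Tree) ]
    Σ[ OPT ∈ (ℕ → ℝ) ]
    Σ[ OPT>0 ∈ (∀ n → 0ℝ < OPT n) ]
    (∀ n → IsOPT (uniform (𝒯 n)) (OPT n)) ×
    (OPT ⟶∞) ×
    (∀ (C : ∀ n → SearchTree (𝒯 n)) → (∀ n → IsCentroidTree (uniform (𝒯 n)) (C n)) →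
    (λ n → cost (uniform (𝒯 n)) (C n) ÷ OPT n [ OPT>0 n ]) ⟶ 2ℝ))
theorem2 =
  (λ ε (e , 0<e , N , e≤ε) → let module W = Weighted (4 ℕ.* ↧ₙ e) in
    W.I , W.OPT , W.OPT-isOPT , W.totalWeight≃1
    , ⟶∞-of-linear-growth (λ n → W.φ n (W.opt n)) W.natural≤OPT
    , weighted-bound ε e N 0<e e≤ε)
  , shape , Uniform.OPT , Uniform.0<OPT , Uniform.OPT-isOPT
  , ⟶∞-of-linear-growth (λ n → Uniform.φ n (Uniform.opt n)) Uniform.natural≤OPT
  , uniform-limit
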